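{- The structure $\mathcal{W}(I)$ is positive-model-complete in the signature $\{\cup,\cap,\bot,c_0,\min,\max,\mathrm{ips}\}$. That is, every first-order formula in this signature is equivalent in $\mathcal{W}(I)$ to a positive existential formula.
   Context: Let $I$ be a dense linear order with left endpoint $0$ and no right endpoint. $\mathcal{W}(I)$ is the structure whose universe is the set of finite subsets of $I$, interpreted as follows. - $\cup$ and $\cap$ are union and intersection. - $\bot$ is $\emptyset$, and $c_0$ is $\{0\}$. - $\min$ and $\max$ send a nonempty finite set to the singleton of its minimum, respectively maximum, and both fix $\emptyset$. - $\mathrm{ips}(A,B)=\{i\in A: s_A(i)\in B\}$, where $s_A$ is the successor function of the finite linear order $A$. A positive existential formula is one built from atomic formulas using only $\wedge$, $\vee$ and $\exists$. -}

module Defs where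

open import Data.Fin.Base using (Fin)
open import Data.List.Base using (List; []; [_]; _∷_; _++_; filter; fromMaybe)
import Data.List.Extrema as Extrema
import Data.List.Membership.DecSetoid as Membership
import Data.List.Relation.Binary.Subset.Setoid as Subset
open import Data.Maybe.Base using (Maybe; just; nothing)
import Data.Maybe.Relation.Unary.Any as MaybeAny
open import Data.Nat.Base using (ℕ; suc)
open import Data.Product.Base using (_×_; Σ-syntax)
open import Data.Sum.Base using (_⊎_)
open import Data.Vec.Functional as Vector using (Vector)
open import Function.Bundles using (_⇔_)
open import Level using (Level; _⊔_) renaming (suc to lsuc)
open import Relation.Binary.Bundles using (DenseLinearOrder; DecTotalOrder)
open import Relation.Binary.Core using (Rel)
import Relation.Binary.Properties.StrictTotalOrder as StrictTotalOrderProperties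
open import Relation.Nullary.Negation using (¬_)

private
  variable
    a ℓ : Level
    n : ℕ

-- First-order syntax over the signature {∪, ∩, ⊥, c₀, min, max, ips}.  The
-- signature has no relation symbols, so equations are the only atomic formulas.
-- Variables are de Bruijn indices: a `Formula n` has its free variables among
-- n given ones, and quantifiers bind index zero.

infixr 9 _∩ᵗ_
infixr 8 _∪ᵗ_

data Term (n : ℕ) : Set where
  var       : Fin n → Term n
  _∪ᵗ_ _∩ᵗ_ : Term n → Term n → Term n
  ⊥ᵗ c₀ᵗ    : Term n
  minᵗ maxᵗ : Term n → Term n
  ipsᵗ      : Term n → Term n → Term n

infix  7 _≐_
infix  6 ¬ᶠ_
infixr 5 _∧ᶠ_
infixr 4 _∨ᶠ_
infixr 3 _⇒ᶠ_
infix  2 ∃ᶠ_ ∀ᶠ_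

data Formula (n : ℕ) : Set where
  _≐_            : Term n → Term n → Formula n
  ¬ᶠ_            : Formula n → Formula n
  _∧ᶠ_ _∨ᶠ_ _⇒ᶠ_ : Formula n → Formula n → Formula n
  ∃ᶠ_ ∀ᶠ_        : Formula (suc n) → Formula n

data PositiveExistential {n : ℕ} : Formula n → Set where
  atomic : ∀ t u → PositiveExistential (t ≐ u)
  _∧ᵖ_   : ∀ {φ ψ} → PositiveExistential φ → PositiveExistential ψ →
           PositiveExistential (φ ∧ᶠ ψ)
  _∨ᵖ_   : ∀ {φ ψ} → PositiveExistential φ → PositiveExistential ψ →
           PositiveExistential (φ ∨ᶠ ψ)
  ∃ᵖ_    : ∀ {φ} → PositiveExistential φ → PositiveExistential (∃ᶠ φ)

-- The equality symbol is interpreted by _≈_, since the universe may be a setoid.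
-- The level of _≈_ is taken above that of Carrier so that all formulas are
-- interpreted at one level.

record Structure a ℓ : Set (lsuc (a ⊔ ℓ)) where
  infixr 7 _∩_
  infixr 6 _∪_
  infix  4 _≈_
  field
    Carrier : Set a
    _≈_     : Rel Carrier (a ⊔ ℓ)
    _∪_ _∩_ : Carrier → Carrier → Carrier
    ⊥ c₀    : Carrier
    min max : Carrier → Carrier
    ips     : Carrier → Carrier → Carrier

module Semantics (M : Structure a ℓ) where
  open Structure M

  ⟦_⟧ : Term n → Vector Carrier n → Carrier
  ⟦ var i ⟧    ρ = ρ i
  ⟦ t ∪ᵗ u ⟧   ρ = ⟦ t ⟧ ρ ∪ ⟦ u ⟧ ρ
  ⟦ t ∩ᵗ u ⟧   ρ = ⟦ t ⟧ ρ ∩ ⟦ u ⟧ ρ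
  ⟦ ⊥ᵗ ⟧       ρ = ⊥
  ⟦ c₀ᵗ ⟧      ρ = c₀
  ⟦ minᵗ t ⟧   ρ = min (⟦ t ⟧ ρ)
  ⟦ maxᵗ t ⟧   ρ = max (⟦ t ⟧ ρ)
  ⟦ ipsᵗ t u ⟧ ρ = ips (⟦ t ⟧ ρ) (⟦ u ⟧ ρ)

  infix 1 _⊨_

  _⊨_ : Vector Carrier n → Formula n → Set (a ⊔ ℓ)
  ρ ⊨ t ≐ u    = ⟦ t ⟧ ρ ≈ ⟦ u ⟧ ρ
  ρ ⊨ ¬ᶠ φ     = ¬ (ρ ⊨ φ)
  ρ ⊨ φ ∧ᶠ ψ   = (ρ ⊨ φ) × (ρ ⊨ ψ)
  ρ ⊨ φ ∨ᶠ ψ   = (ρ ⊨ φ) ⊎ (ρ ⊨ ψ)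
  ρ ⊨ φ ⇒ᶠ ψ   = (ρ ⊨ φ) → (ρ ⊨ ψ)
  ρ ⊨ ∃ᶠ φ     = Σ[ x ∈ Carrier ] ((x Vector.∷ ρ) ⊨ φ)
  ρ ⊨ ∀ᶠ φ     = (x : Carrier) → ((x Vector.∷ ρ) ⊨ φ)

  Equivalent : Formula n → Formula n → Set (a ⊔ ℓ)
  Equivalent φ ψ = ∀ ρ → (ρ ⊨ φ) ⇔ (ρ ⊨ ψ)

PositiveModelComplete : Structure a ℓ → Set (a ⊔ ℓ)
PositiveModelComplete M =
  ∀ {n} (φ : Formula n) →
  Σ[ ψ ∈ Formula n ] (PositiveExistential ψ × Equivalent φ ψ)
  where open Semantics M

-- Finite subsets of I are lists, in any order and possibly with repetitions,
-- identified when they have the same members up to the equality of I.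

module FiniteSubsets {c ℓ₁ ℓ₂} (I : DenseLinearOrder c ℓ₁ ℓ₂) where
  open DenseLinearOrder I
  open Membership Eq.decSetoid using (_∈?_)
  open Subset Eq.setoid using (_⊆_)
  open Extrema
    (DecTotalOrder.totalOrder
      (StrictTotalOrderProperties.decTotalOrder strictTotalOrder))
    using () renaming (min to minimum; max to maximum)

  FinSet : Set c
  FinSet = List Carrier

  infix 4 _≋_
  _≋_ : Rel FinSet (c ⊔ ℓ₁)
  A ≋ B = (A ⊆ B) × (B ⊆ A)

  _∩_ : FinSet → FinSet → FinSet
  A ∩ B = filter (_∈? B) A

  least greatest : FinSet → Maybe Carrier
  least    []      = nothing
  least    (x ∷ A) = just (minimum x A)
  greatest []      = nothing
  greatest (x ∷ A) = just (maximum x A)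

  -- The partial successor function of A: the least element of A above i,
  -- undefined at the maximum of A.
  successor : FinSet → Carrier → Maybe Carrier
  successor A i = least (filter (i <?_) A)

  -- Only those i whose successor exists and lies in B are kept.
  ips : FinSet → FinSet → FinSet
  ips A B = filter (λ i → MaybeAny.dec (_∈? B) (successor A i)) A

  𝒲 : Carrier → Structure c ℓ₁
  𝒲 0# = record
    { Carrier = FinSet
    ; _≈_     = _≋_
    ; _∪_     = _++_
    ; _∩_     = _∩_
    ; ⊥       = []
    ; c₀      = [ 0# ]
    ; min     = λ A → fromMaybe (least A)
    ; max     = λ A → fromMaybe (greatest A)
    ; ips     = ips
    }

open FiniteSubsets public using (𝒲)

-- A tuple ρ of finite sets is read as a finite word: list the points of the sets
-- in increasing order, starting with 0, and write at each point the tuple of bits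
-- saying which sets contain it.  The relations defined by first-order formulas are
-- regular: union, intersection, the order and negation are handled by finite
-- automata as usual, and ∃X becomes projection of a track, where new points lying
-- in X only may appear in every gap of the word and after its end, since I is
-- dense and unbounded, but not before 0.  Conversely, that a deterministic
-- automaton accepts the word of ρ is positive existential: guess a set U of points
-- containing 0 and all of ρ, the complements in U of the members of ρ, and sets
-- Q q containing the points of U where the run is in state q.  The transitions are
-- inclusions between terms with ips, and acceptance says that the maximum of U
-- avoids Q q for every rejecting q.

{-# OPTIONS --safe #-}
module Submission where

open import Defs
open import Data.Bool.Base using (Bool; true; false; if_then_else_; not; T; _∧_; _∨_)
open import Data.Bool.Properties using (T?)
open import Data.Fin.Base
  using (Fin; zero; suc; _↑ˡ_; _↑ʳ_; combine; remQuot; finToFun; funToFin)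
open import Data.Fin.Properties as Fin using (any?; finToFun-funToFin; remQuot-combine)
open import Data.List.Base
  using (List; []; [_]; _∷_; allFin; cartesianProductWith; filter; fromMaybe)
import Data.List.Extrema as Extrema
import Data.List.Membership.DecSetoid as DecMembership
open import Data.List.Membership.Propositional using () renaming (_∈_ to _∈ₚ_)
open import Data.List.Membership.Propositional.Properties
  using (∈-allFin; ∈-cartesianProductWith⁺)
import Data.List.Membership.Setoid.Properties as Membershipₚ
open import Data.List.Properties using (filter-accept; filter-≐)
open import Data.List.Relation.Binary.Sublist.Propositional as Sublist
  using ([]; _∷_; _∷ʳ_) renaming (_⊆_ to _⊑_)
import Data.List.Relation.Binary.Subset.Setoid as Subset
open import Data.List.Relation.Unary.All as All using ()
open import Data.List.Relation.Unary.Any as Any using (Any; here; there)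
open import Data.List.Relation.Unary.Linked as Linked using (Linked; [-]; _∷_)
import Data.List.Relation.Unary.Linked.Properties as Linkedₚ
open import Data.Maybe.Relation.Unary.Any as MaybeAny using (just)
open import Data.Nat.Base using (ℕ; zero; suc; _+_; _*_; _^_)
open import Data.Product.Base as Product
  using (Σ-syntax; ∃-syntax; _×_; _,_; proj₁; proj₂)
open import Data.Sum.Base as Sum using (_⊎_; inj₁; inj₂)
open import Data.Vec.Base as Vec using (Vec; []; _∷_)
open import Data.Vec.Functional as Vector using (Vector)
open import Data.Vec.Properties using (lookup∘tabulate; tabulate-cong; ∷-injective)
open import Function.Base using (_∘_; id)
open import Function.Bundles using (_⇔_; mk⇔; module Equivalence)
open import Level using (Level; _⊔_)
open import Relation.Binary.Bundles using (DecTotalOrder; DenseLinearOrder)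
open import Relation.Binary.Construct.Closure.ReflexiveTransitive
  using (Star; ε; _◅_; _◅◅_)
open import Relation.Binary.Core using (Rel)
open import Relation.Binary.Definitions
  using (Decidable; DecidableEquality; tri<; tri≈; tri>)
import Relation.Binary.Properties.StrictTotalOrder as StrictTotalOrderProperties
open import Relation.Binary.PropositionalEquality
  using (_≡_; refl; cong; cong₂; subst) renaming (sym to ≡-sym; trans to ≡-trans)
open import Relation.Nullary
  using (Dec; yes; no; does; Reflects; ofʸ; ofⁿ; contradiction; map′; _because_;
         ¬?; _×-dec_; _⊎-dec_)
open import Relation.Nullary.Decidable using (dec-false; dec-true; decidable-stable; does-⇔)
open import Relation.Nullary.Negation using (¬_)
open import Relation.Nullary.Reflects
  using (fromEquivalence; ¬-reflects; _×-reflects_; _⊎-reflects_; _→-reflects_)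

open Equivalence using (to; from)

-- Membership in the values of the operations on finite sets.

module FiniteSets {c ℓ₁ ℓ₂} (I : DenseLinearOrder c ℓ₁ ℓ₂) where
  open DenseLinearOrder I
  open FiniteSubsets I public hiding (𝒲)
  open DecMembership Eq.decSetoid public using (_∈_; _∉_; _∈?_)
  open Subset Eq.setoid public using (_⊆_)
  open Extrema
    (DecTotalOrder.totalOrder
      (StrictTotalOrderProperties.decTotalOrder strictTotalOrder))
    using (argmin-sel; argmax-sel; min≤⊤; min≤xs; ⊥≤max; xs≤max)
    renaming (min to minimum; max to maximum)

  private
    variable
      x y : Carrier
      A B : FinSet

  ∈-resp-≈ : ∀ A → x ≈ y → x ∈ A → y ∈ A
  ∈-resp-≈ _ = Membershipₚ.∈-resp-≈ Eq.setoid

  ∈-[]⁻ : x ∈ [ y ] → x ≈ y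
  ∈-[]⁻ (here x≈y) = x≈y

  ≮∧≯⇒≈ : ¬ (x < y) → ¬ (y < x) → x ≈ y
  ≮∧≯⇒≈ {x} {y} x≮y y≮x with compare x y
  ... | tri< x<y _ _ = contradiction x<y x≮y
  ... | tri≈ _ x≈y _ = x≈y
  ... | tri> _ _ y<x = contradiction y<x y≮x

  ≤⇒≯ : x < y ⊎ x ≈ y → ¬ (y < x)
  ≤⇒≯ (inj₁ x<y) = asym x<y
  ≤⇒≯ (inj₂ x≈y) = irrefl (Eq.sym x≈y)

  ∈-∩⁺ : ∀ {A B} → x ∈ A → x ∈ B → x ∈ A ∩ B
  ∈-∩⁺ {B = B} = Membershipₚ.∈-filter⁺ Eq.setoid (_∈? B) (∈-resp-≈ B)

  ∈-∩⁻ : ∀ {A B} → x ∈ A ∩ B → x ∈ A × x ∈ B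
  ∈-∩⁻ {B = B} = Membershipₚ.∈-filter⁻ Eq.setoid (_∈? B) (∈-resp-≈ B)

  IsLeast IsGreatest : FinSet → Carrier → Set _
  IsLeast    A x = x ∈ A × (∀ {y} → y ∈ A → ¬ (y < x))
  IsGreatest A x = x ∈ A × (∀ {y} → y ∈ A → ¬ (x < y))

  least-isLeast : ∀ x A → IsLeast (x ∷ A) (minimum x A)
  least-isLeast x A = ∈⁺ (argmin-sel _ x A) , lower
    where
    ∈⁺ : ∀ {m} → m ≡ x ⊎ Any (m ≡_) A → m ∈ x ∷ A
    ∈⁺ (inj₁ m≡x) = here (Eq.reflexive m≡x)
    ∈⁺ (inj₂ m∈A) = there (Any.map Eq.reflexive m∈A)
    lower : ∀ {y} → y ∈ x ∷ A → ¬ (y < minimum x A)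
    lower (here y≈x)  y<m = ≤⇒≯ (min≤⊤ x A) (<-respˡ-≈ y≈x y<m)
    lower (there y∈A) y<m with All.lookupAny (min≤xs x A) y∈A
    ... | m≤z , y≈z = ≤⇒≯ m≤z (<-respˡ-≈ y≈z y<m)

  greatest-isGreatest : ∀ x A → IsGreatest (x ∷ A) (maximum x A)
  greatest-isGreatest x A = ∈⁺ (argmax-sel _ x A) , upper
    where
    ∈⁺ : ∀ {m} → m ≡ x ⊎ Any (m ≡_) A → m ∈ x ∷ A
    ∈⁺ (inj₁ m≡x) = here (Eq.reflexive m≡x)
    ∈⁺ (inj₂ m∈A) = there (Any.map Eq.reflexive m∈A)
    upper : ∀ {y} → y ∈ x ∷ A → ¬ (maximum x A < y)
    upper (here y≈x)  m<y = ≤⇒≯ (⊥≤max x A) (<-respʳ-≈ y≈x m<y)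
    upper (there y∈A) m<y with All.lookupAny (xs≤max x A) y∈A
    ... | z≤m , y≈z = ≤⇒≯ z≤m (<-respʳ-≈ y≈z m<y)

  isLeast-unique : IsLeast A x → IsLeast A y → x ≈ y
  isLeast-unique (x∈A , x-min) (y∈A , y-min) = ≮∧≯⇒≈ (y-min x∈A) (x-min y∈A)

  isGreatest-unique : IsGreatest A x → IsGreatest A y → x ≈ y
  isGreatest-unique (x∈A , x-max) (y∈A , y-max) = ≮∧≯⇒≈ (x-max y∈A) (y-max x∈A)

  isLeast-resp-≈ : x ≈ y → IsLeast A x → IsLeast A y
  isLeast-resp-≈ x≈y (x∈A , x-min) =
    ∈-resp-≈ _ x≈y x∈A , λ z∈A z<y → x-min z∈A (<-respʳ-≈ (Eq.sym x≈y) z<y)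

  isGreatest-resp-≈ : x ≈ y → IsGreatest A x → IsGreatest A y
  isGreatest-resp-≈ x≈y (x∈A , x-max) =
    ∈-resp-≈ _ x≈y x∈A , λ z∈A y<z → x-max z∈A (<-respˡ-≈ (Eq.sym x≈y) y<z)

  ∈-min : ∀ A → x ∈ fromMaybe (least A) ⇔ IsLeast A x
  ∈-min []      = mk⇔ (λ ()) (λ { (() , _) })
  ∈-min (z ∷ A) = mk⇔
    (λ x∈ → isLeast-resp-≈ (Eq.sym (∈-[]⁻ x∈)) (least-isLeast z A))
    (λ x-min → here (isLeast-unique x-min (least-isLeast z A)))

  ∈-max : ∀ A → x ∈ fromMaybe (greatest A) ⇔ IsGreatest A x
  ∈-max []      = mk⇔ (λ ()) (λ { (() , _) })
  ∈-max (z ∷ A) = mk⇔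
    (λ x∈ → isGreatest-resp-≈ (Eq.sym (∈-[]⁻ x∈)) (greatest-isGreatest z A))
    (λ x-max → here (isGreatest-unique x-max (greatest-isGreatest z A)))

  record IsSuccessor (A : FinSet) (x y : Carrier) : Set (c ⊔ ℓ₁ ⊔ ℓ₂) where
    constructor isSuccessor
    field
      member  : y ∈ A
      above   : x < y
      closest : ∀ {z} → z ∈ A → x < z → ¬ (z < y)

  ∈-filter> : ∀ {A} → y ∈ filter (x <?_) A ⇔ (y ∈ A × x < y)
  ∈-filter> {x = x} = mk⇔
    (Membershipₚ.∈-filter⁻ Eq.setoid (x <?_) <-respʳ-≈)
    (λ (y∈A , x<y) → Membershipₚ.∈-filter⁺ Eq.setoid (x <?_) <-respʳ-≈ y∈A x<y)

  ∈-successor : ∀ {x} A B →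
    MaybeAny.Any (_∈ B) (successor A x) ⇔ (∃[ y ] IsSuccessor A x y × y ∈ B)
  ∈-successor {x} A B = go (filter (x <?_) A) (λ _ → ∈-filter>)
    where
    -- The filtered list is generalised to any list with the same members, so that `least` can be
    -- computed by cases on that list.
    go : ∀ A> → (∀ y → y ∈ A> ⇔ (y ∈ A × x < y)) →
         MaybeAny.Any (_∈ B) (least A>) ⇔ (∃[ y ] IsSuccessor A x y × y ∈ B)
    go []       A>⇔ = mk⇔ (λ ())
      (λ { (y , isSuccessor y∈A x<y _ , _) → contradiction (from (A>⇔ y) (y∈A , x<y)) λ () })
    go (z ∷ A>) A>⇔ = mk⇔
      (λ { (just m∈B) → let m∈A , x<m = to (A>⇔ m) (proj₁ m-min) in
             m , isSuccessor m∈A x<m (λ z∈A x<z → proj₂ m-min (from (A>⇔ _) (z∈A , x<z))) , m∈B })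
      (λ { (y , isSuccessor y∈A x<y y-min , y∈B) → just (∈-resp-≈ B (isLeast-unique {A = z ∷ A>}
             (from (A>⇔ y) (y∈A , x<y) ,
              λ w∈A> → y-min (proj₁ (to (A>⇔ _) w∈A>)) (proj₂ (to (A>⇔ _) w∈A>)))
             m-min) y∈B) })
      where
      m : Carrier
      m = minimum z A>
      m-min : IsLeast (z ∷ A>) m
      m-min = least-isLeast z A>

  ∈-ips : ∀ A B → x ∈ ips A B ⇔ (x ∈ A × (∃[ y ] IsSuccessor A x y × y ∈ B))
  ∈-ips A B = mk⇔
    (λ x∈ → let x∈A , s = Membershipₚ.∈-filter⁻ Eq.setoid P? resp x∈ in x∈A , to (∈-successor A B) s)
    (λ (x∈A , s) → Membershipₚ.∈-filter⁺ Eq.setoid P? resp x∈A (from (∈-successor A B) s))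
    where
    P? = λ i → MaybeAny.dec (_∈? B) (successor A i)
    -- For equal points the filters defining `successor` select the same list, not merely one with
    -- the same members.
    resp : ∀ {x y} → x ≈ y → MaybeAny.Any (_∈ B) (successor A x) → MaybeAny.Any (_∈ B) (successor A y)
    resp x≈y = subst (MaybeAny.Any (_∈ B) ∘ least)
      (filter-≐ (_ <?_) (_ <?_) (<-respˡ-≈ x≈y , <-respˡ-≈ (Eq.sym x≈y)) A)

-- Decidable reachability in a finite graph.

-- Warshall's algorithm: paths in Via ss have all intermediate states in ss.
module Reachability {a e} {S : Set a} {E : Rel S e}
  (_≟_ : DecidableEquality S) (E? : Decidable E) where

  private
    variable
      p q s : S
      ss : List S

  Via : List S → Rel S (a ⊔ e)
  Via []       p q = p ≡ q ⊎ E p q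
  Via (s ∷ ss) p q = Via ss p q ⊎ (Via ss p s × Via ss s q)

  via? : ∀ ss → Decidable (Via ss)
  via? []       p q = (p ≟ q) ⊎-dec E? p q
  via? (s ∷ ss) p q = via? ss p q ⊎-dec (via? ss p s ×-dec via? ss s q)

  via⇒star : ∀ ss → Via ss p q → Star E p q
  via⇒star []       (inj₁ refl)      = ε
  via⇒star []       (inj₂ pq)        = pq ◅ ε
  via⇒star (s ∷ ss) (inj₁ pq)        = via⇒star ss pq
  via⇒star (s ∷ ss) (inj₂ (ps , sq)) = via⇒star ss ps ◅◅ via⇒star ss sq

  via-edge : ∀ ss → p ≡ q ⊎ E p q → Via ss p q
  via-edge []       pq = pq
  via-edge (s ∷ ss) pq = inj₁ (via-edge ss pq)

  -- Loops are cut off. If `s` is the head of the list, the path into `s` is kept only up to a visit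
  -- to `s`, and the path out of `s` only from one. If both paths pass through another head,
  -- everything between the two visits to it is dropped.
  via-trans : s ∈ₚ ss → Via ss p s → Via ss s q → Via ss p q
  via-trans {s = s} {ss = _ ∷ ss} (here refl) ps sq = inj₂ (front ps , back sq)
    where
    front : ∀ {p} → Via (s ∷ ss) p s → Via ss p s
    front (inj₁ ps)       = ps
    front (inj₂ (ps , _)) = ps
    back : ∀ {q} → Via (s ∷ ss) s q → Via ss s q
    back (inj₁ sq)       = sq
    back (inj₂ (_ , sq)) = sq
  via-trans (there s∈) (inj₁ ps)         (inj₁ sq)         = inj₁ (via-trans s∈ ps sq)
  via-trans (there s∈) (inj₁ ps)         (inj₂ (st , tq))  = inj₂ (via-trans s∈ ps st , tq)
  via-trans (there s∈) (inj₂ (pt , ts))  (inj₁ sq)         = inj₂ (pt , via-trans s∈ ts sq)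
  via-trans (there s∈) (inj₂ (pt , _))   (inj₂ (_ , tq))   = inj₂ (pt , tq)

  star⇒via : (∀ s → s ∈ₚ ss) → Star E p q → Via ss p q
  star⇒via {ss} all ε          = via-edge ss (inj₁ refl)
  star⇒via {ss} all (pr ◅ rq) = via-trans (all _) (via-edge ss (inj₂ pr)) (star⇒via all rq)

  star? : ∀ ss → (∀ s → s ∈ₚ ss) → Decidable (Star E)
  star? ss all p q = map′ (via⇒star ss) (star⇒via all) (via? ss p q)

-- The subset construction for projecting a track.

bit : Bool → Fin 2
bit b = if b then suc zero else zero

-- Sets of states of an automaton, coded as states of its determinisation.
module _ {m : ℕ} where

  infix 4 _∋_ _∋?_

  _∋_ : Fin (2 ^ m) → Fin m → Set
  S ∋ q = finToFun S q ≡ suc zero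

  _∋?_ : Decidable _∋_
  S ∋? q = finToFun S q Fin.≟ suc zero

  encode : ∀ {p} {P : Fin m → Set p} → (∀ q → Dec (P q)) → Fin (2 ^ m)
  encode P? = funToFin (λ q → bit (does (P? q)))

  ∋-encode : ∀ {p} {P : Fin m → Set p} (P? : ∀ q → Dec (P q)) {q} → encode P? ∋ q ⇔ P q
  ∋-encode P? {q} rewrite finToFun-funToFin (λ q → bit (does (P? q))) q
    with P? q
  ... | yes Pq = mk⇔ (λ _ → Pq) (λ _ → refl)
  ... | no ¬Pq = mk⇔ (λ ()) (λ Pq → contradiction Pq ¬Pq)

anyBool? : ∀ {p} {P : Bool → Set p} → (∀ b → Dec (P b)) → Dec (∃[ b ] P b)
anyBool? P? = map′
  (λ { (inj₁ p) → _ , p ; (inj₂ p) → _ , p })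
  (λ { (false , p) → inj₁ p ; (true , p) → inj₂ p })
  (P? false ⊎-dec P? true)

record Automaton (n : ℕ) : Set where
  field
    {states} : ℕ
    start    : Fin states
    step     : Vec Bool n → Fin states → Fin states
    final    : Fin states → Bool

blank : ∀ {n} → Vec Bool n
blank = Vec.tabulate (λ _ → false)

-- Guesses the first track of the word.  Points lying only in the guessed set
-- may be inserted after any point of the word, but not before the first one,
-- which is the left endpoint.
module Projection {n} (A : Automaton (suc n)) where
  open Automaton A

  -- The bit of an inserted point may also be `false`: words are read off lists that may contain
  -- points of no set at all, so such letters can occur.
  Skip : Rel (Fin states) _
  Skip p q = ∃[ b ] step (b ∷ blank) p ≡ q

  skip? : Decidable Skip
  skip? p q = anyBool? (λ b → step (b ∷ blank) p Fin.≟ q)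

  Step : Vec Bool n → Fin (2 ^ states) → Fin states → Set
  Step a S q = ∃[ p ] S ∋ p × ∃[ b ] Star Skip (step (b ∷ a) p) q

  step? : ∀ a S q → Dec (Step a S q)
  step? a S q = any? λ p → S ∋? p ×-dec anyBool? λ b →
    Reachability.star? Fin._≟_ skip? (allFin states) ∈-allFin (step (b ∷ a) p) q

  final? : ∀ S → Dec (∃[ q ] S ∋ q × T (final q))
  final? S = any? λ q → S ∋? q ×-dec T? (final q)

  projection : Automaton n
  projection = record
    { start = encode (Fin._≟ start)
    ; step  = λ a S → encode (step? a S)
    ; final = λ S → does (final? S)
    }

-- Positive existential formulas and the description of a run.

letters : ∀ n → List (Vec Bool n)
letters zero    = [] ∷ []
letters (suc n) = cartesianProductWith _∷_ (false ∷ true ∷ []) (letters n)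

∈-letters : ∀ {n} (a : Vec Bool n) → a ∈ₚ letters n
∈-letters []          = here refl
∈-letters (false ∷ a) = ∈-cartesianProductWith⁺ _∷_ {false ∷ true ∷ []} {letters _} (here refl) (∈-letters a)
∈-letters (true ∷ a)  = ∈-cartesianProductWith⁺ _∷_ {false ∷ true ∷ []} {letters _} (there (here refl)) (∈-letters a)

infix 7 _⊑ᵗ_

_⊑ᵗ_ : ∀ {n} → Term n → Term n → Formula n
t ⊑ᵗ u = t ∪ᵗ u ≐ u

⋀ : ∀ {a n} {A : Set a} → List A → (A → Formula n) → Formula n
⋀ []       φ = ⊥ᵗ ≐ ⊥ᵗ
⋀ (x ∷ xs) φ = φ x ∧ᶠ ⋀ xs φ

⋀-positive : ∀ {a n} {A : Set a} {φ : A → Formula n} xs →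
             (∀ x → PositiveExistential (φ x)) → PositiveExistential (⋀ xs φ)
⋀-positive []       φ-pos = atomic _ _
⋀-positive (x ∷ xs) φ-pos = φ-pos x ∧ᵖ ⋀-positive xs φ-pos

∃ⁿ : ∀ k {n} → Formula (k + n) → Formula n
∃ⁿ zero    φ = φ
∃ⁿ (suc k) φ = ∃ⁿ k (∃ᶠ φ)

∃ⁿ-positive : ∀ k {n} {φ : Formula (k + n)} → PositiveExistential φ → PositiveExistential (∃ⁿ k φ)
∃ⁿ-positive zero    φ-pos = φ-pos
∃ⁿ-positive (suc k) φ-pos = ∃ⁿ-positive k (∃ᵖ φ-pos)

extend : ∀ {a k n} {A : Set a} → Vec A k → Vector A n → Vector A (k + n)
extend []       ρ = ρ
extend (x ∷ xs) ρ = x Vector.∷ extend xs ρ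

extend-↑ˡ : ∀ {a k n} {A : Set a} (xs : Vec A k) (ρ : Vector A n) i →
            extend xs ρ (i ↑ˡ n) ≡ Vec.lookup xs i
extend-↑ˡ (x ∷ xs) ρ zero    = refl
extend-↑ˡ (x ∷ xs) ρ (suc i) = extend-↑ˡ xs ρ i

extend-↑ʳ : ∀ {a k n} {A : Set a} (xs : Vec A k) (ρ : Vector A n) i →
            extend xs ρ (k ↑ʳ i) ≡ ρ i
extend-↑ʳ []       ρ i = refl
extend-↑ʳ (x ∷ xs) ρ i = extend-↑ʳ xs ρ i

-- Here u stands for a set U of points containing 0 and the sets Aᵗ j, the Cᵗ j for
-- their complements in U, and Qᵗ q for a set containing the points of U at which the
-- automaton, having read the letter there, is in state q.  Such a superset suffices:
-- the inclusions propagate along the one run, and no Qᵗ q with q rejecting may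
-- contain the maximum of U.
module Description {n k} (A : Automaton n)
  (u : Term k) (Aᵗ Cᵗ : Fin n → Term k) (Qᵗ : Fin (Automaton.states A) → Term k) where

  open Automaton A

  -- Once the complements are as intended, these are the points of U whose letter is the given one;
  -- `u` serves as the empty intersection.
  letterᵗ : ∀ {n} → Vec Bool n → (Fin n → Term k) → (Fin n → Term k) → Term k
  letterᵗ []      Aᵗ Cᵗ = u
  letterᵗ (b ∷ a) Aᵗ Cᵗ = (if b then Aᵗ zero else Cᵗ zero) ∩ᵗ letterᵗ a (Aᵗ ∘ suc) (Cᵗ ∘ suc)

  description : Formula k
  description =
       c₀ᵗ ⊑ᵗ u
    ∧ᶠ ⋀ (allFin n) (λ j → Aᵗ j ⊑ᵗ u)
    ∧ᶠ ⋀ (allFin n) (λ j → u ⊑ᵗ Aᵗ j ∪ᵗ Cᵗ j)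
    ∧ᶠ ⋀ (allFin n) (λ j → Aᵗ j ∩ᵗ Cᵗ j ⊑ᵗ ⊥ᵗ)
    ∧ᶠ ⋀ (letters n) (λ a → c₀ᵗ ∩ᵗ letterᵗ a Aᵗ Cᵗ ⊑ᵗ Qᵗ (step a start))
    -- `ipsᵗ u X` collects the points of U whose successor in U lies in X. A point in `Qᵗ q`
    -- followed by the letter `a` must thus have its successor in `Qᵗ (step a q)`.
    ∧ᶠ ⋀ (allFin states) (λ q → ⋀ (letters n) λ a →
         Qᵗ q ∩ᵗ ipsᵗ u (letterᵗ a Aᵗ Cᵗ) ⊑ᵗ ipsᵗ u (Qᵗ (step a q)))
    -- For accepting `q` the bound `u` holds trivially, since the maximum of U lies in U.
    ∧ᶠ ⋀ (allFin states) (λ q → maxᵗ u ∩ᵗ Qᵗ q ⊑ᵗ (if final q then u else ⊥ᵗ))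

  description-positive : PositiveExistential description
  description-positive =
    atomic _ _
    ∧ᵖ (⋀-positive (allFin n) (λ _ → atomic _ _)
    ∧ᵖ (⋀-positive (allFin n) (λ _ → atomic _ _)
    ∧ᵖ (⋀-positive (allFin n) (λ _ → atomic _ _)
    ∧ᵖ (⋀-positive (letters n) (λ _ → atomic _ _)
    ∧ᵖ (⋀-positive (allFin states) (λ _ → ⋀-positive (letters n) (λ _ → atomic _ _))
    ∧ᵖ ⋀-positive (allFin states) (λ _ → atomic _ _))))))

-- Words of tuples of finite sets, and relations recognised by automata.

module Definability {c ℓ₁ ℓ₂} (I : DenseLinearOrder c ℓ₁ ℓ₂)
  (0# : DenseLinearOrder.Carrier I)
  (0-least : ∀ x → ¬ (DenseLinearOrder._<_ I x 0#))
  (unbounded : ∀ x → ∃[ y ] DenseLinearOrder._<_ I x y) where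

  open DenseLinearOrder I
  open FiniteSets I

  private
    variable
      m n : ℕ
      p r : Level
      w x y z k : Carrier
      L L⁺ : List Carrier
      X : FinSet
      ρ σ : Vector FinSet n

  letter : Vector FinSet n → Carrier → Vec Bool n
  letter ρ x = Vec.tabulate (λ j → does (x ∈? ρ j))

  letter-cong : (∀ j → x ∈ ρ j ⇔ y ∈ σ j) → letter ρ x ≡ letter σ y
  letter-cong x⇔y = tabulate-cong (λ j → does-⇔ (x⇔y j) (_ ∈? _) (_ ∈? _))

  letter-resp-≈ : x ≈ y → letter ρ x ≡ letter ρ y
  letter-resp-≈ {ρ = ρ} x≈y =
    letter-cong (λ j → mk⇔ (∈-resp-≈ (ρ j) x≈y) (∈-resp-≈ (ρ j) (Eq.sym x≈y)))

  letter-blank : (∀ j → x ∉ ρ j) → letter ρ x ≡ blank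
  letter-blank x∉ = tabulate-cong (λ j → dec-false (_ ∈? _) (x∉ j))

  Sorted : Carrier → List Carrier → Set _
  Sorted w L = Linked _<_ (w ∷ L)

  above : Sorted w L → x ∈ L → w < x
  above (w<y ∷ _) (here x≈y)  = <-respʳ-≈ (Eq.sym x≈y) w<y
  above (w<y ∷ s) (there x∈L) = trans w<y (above s x∈L)

  self-∉ : Sorted w L → w ∉ L
  self-∉ s w∈L = irrefl Eq.refl (above s w∈L)

  Covers : Carrier → Vector FinSet n → List Carrier → Set _
  Covers w ρ L = ∀ j {x} → x ∈ ρ j → w < x → x ∈ L

  covers-tail : Covers w ρ (z ∷ L) → w < z → Covers z ρ L
  covers-tail cov w<z j x∈ z<x with cov j x∈ (trans w<z z<x)
  ... | here x≈z  = contradiction z<x (irrefl (Eq.sym x≈z))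
  ... | there x∈L = x∈L

  uncovered-blank : Covers w ρ L → w < z → z ∉ L → letter ρ z ≡ blank
  uncovered-blank cov w<z z∉L = letter-blank (λ j z∈ → z∉L (cov j z∈ w<z))

  insert : Sorted w L → w < x → ∃[ L⁺ ] L ⊑ L⁺ × Sorted w L⁺ × x ∈ L⁺
  insert {x = x} [-] w<x = x ∷ [] , x ∷ʳ [] , w<x ∷ [-] , here Eq.refl
  insert {L = y ∷ L} {x = x} (w<y ∷ s) w<x with compare x y
  ... | tri< x<y _ _ = x ∷ y ∷ L , x ∷ʳ Sublist.⊆-refl , w<x ∷ x<y ∷ s , here Eq.refl
  ... | tri≈ _ x≈y _ = y ∷ L , Sublist.⊆-refl , w<y ∷ s , here x≈y
  ... | tri> _ _ y<x with insert s y<x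
  ...   | L⁺ , L⊑L⁺ , s⁺ , x∈L⁺ = y ∷ L⁺ , refl ∷ L⊑L⁺ , w<y ∷ s⁺ , there x∈L⁺

  ⊑⇒⊆ : L ⊑ L⁺ → L ⊆ L⁺
  ⊑⇒⊆ L⊑L⁺ = Sublist.lookup L⊑L⁺

  insertAll : ∀ X → Sorted w L → ∃[ L⁺ ] L ⊑ L⁺ × Sorted w L⁺ × (∀ {x} → x ∈ X → w < x → x ∈ L⁺)
  insertAll []      s = _ , Sublist.⊆-refl , s , λ ()
  insertAll {w = w} (z ∷ X) s with insertAll X s
  ... | L₁ , L⊑L₁ , s₁ , X⊆L₁ with w <? z
  ...   | no w≮z = L₁ , L⊑L₁ , s₁ , λ where
          (here x≈z)  w<x → contradiction (<-respʳ-≈ x≈z w<x) w≮z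
          (there x∈X) w<x → X⊆L₁ x∈X w<x
  ...   | yes w<z with insert s₁ w<z
  ...     | L₂ , L₁⊑L₂ , s₂ , z∈L₂ = L₂ , Sublist.⊆-trans L⊑L₁ L₁⊑L₂ , s₂ , λ where
            (here x≈z)  _   → ∈-resp-≈ L₂ (Eq.sym x≈z) z∈L₂
            (there x∈X) w<x → ⊑⇒⊆ L₁⊑L₂ (X⊆L₁ x∈X w<x)

  -- The word of `ρ` is read at the points `0# ∷ L`. Points in none of the sets are allowed, so that
  -- a cover of a longer tuple still covers its tail.
  record Cover {n} (ρ : Vector FinSet n) (L : List Carrier) : Set (c ⊔ ℓ₁ ⊔ ℓ₂) where
    constructor cover
    field
      sorted : Sorted 0# L
      covers : Covers 0# ρ L

  -- The proof of `L ⊑ L⁺` marks each point of the new list as old or inserted, which is what an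
  -- induction comparing the two words needs.
  extendCover : Cover ρ L → ∀ X → ∃[ L⁺ ] L ⊑ L⁺ × Cover (X Vector.∷ ρ) L⁺
  extendCover (cover s cov) X with insertAll X s
  ... | L⁺ , L⊑L⁺ , s⁺ , X⊆L⁺ = L⁺ , L⊑L⁺ , cover s⁺ λ where
    zero            → X⊆L⁺
    (suc j) x∈ 0<x → ⊑⇒⊆ L⊑L⁺ (cov j x∈ 0<x)

  cover-exists : ∀ {n} (ρ : Vector FinSet n) → ∃[ L ] Cover ρ L
  cover-exists {zero}  ρ = [] , cover [-] λ ()
  cover-exists {suc n} ρ with cover-exists (Vector.tail ρ)
  ... | L , cov with extendCover cov (Vector.head ρ)
  ...   | L⁺ , _ , cover s covs = L⁺ , cover s λ { zero → covs zero ; (suc j) → covs (suc j) }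

  module _ {S : Set} (δ : Vec Bool n → S → S) where

    run : Vector FinSet n → S → List Carrier → S
    run ρ q []      = q
    run ρ q (x ∷ L) = run ρ (δ (letter ρ x) q) L

    run-cong : ∀ L → (∀ {x} → x ∈ L → letter ρ x ≡ letter σ x) → ∀ q → run ρ q L ≡ run σ q L
    run-cong []      ≡letter q = refl
    run-cong (x ∷ L) ≡letter q rewrite ≡letter (here Eq.refl) = run-cong L (≡letter ∘ there) _

  accepts : Automaton n → Vector FinSet n → List Carrier → Bool
  accepts A ρ L = final (run step ρ start (0# ∷ L))
    where open Automaton A

  -- The verdict must be right on every cover, so blank letters after the first one cannot affect
  -- it. Any convenient cover may therefore be chosen.
  Recognises : Automaton n → (Vector FinSet n → Set p) → Set _
  Recognises A P = ∀ {ρ L} → Cover ρ L → Reflects (P ρ) (accepts A ρ L)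

  Definable : (Vector FinSet n → Set p) → Set _
  Definable {n} P = Σ[ A ∈ Automaton n ] Recognises A P

  definable? : {P : Vector FinSet n → Set p} → Definable P → ∀ ρ → Dec (P ρ)
  definable? (A , A-rec) ρ = _ because A-rec (proj₂ (cover-exists ρ))

  reflects⇒ : ∀ {P : Set p} {b} → Reflects P b → T b → P
  reflects⇒ (ofʸ Px) _ = Px

  reflects⇐ : ∀ {P : Set p} {b} → Reflects P b → P → T b
  reflects⇐ (ofʸ _)   _  = _
  reflects⇐ (ofⁿ ¬Px) Px = ¬Px Px

  definable-⇔ : {P : Vector FinSet n → Set p} {R : Vector FinSet n → Set r} →
                (∀ ρ → P ρ ⇔ R ρ) → Definable P → Definable R
  definable-⇔ P⇔R (A , A-rec) = A , λ {ρ} cov → fromEquivalence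
    (to (P⇔R ρ) ∘ reflects⇒ (A-rec cov))
    (reflects⇐ (A-rec cov) ∘ from (P⇔R ρ))

  -- Tuples with the same members have the same covers and the same letters, hence the same runs.
  definable-resp-≋ : {P : Vector FinSet n → Set p} → Definable P →
                     (∀ j → ρ j ≋ σ j) → P ρ → P σ
  definable-resp-≋ {ρ = ρ} {σ = σ} (A , A-rec) ρ≋σ Pρ with cover-exists ρ
  ... | L , cover s cov =
    reflects⇒ (A-rec (cover s λ j x∈ → cov j (proj₂ (ρ≋σ j) x∈)))
      (subst (T ∘ Automaton.final A)
        (run-cong (Automaton.step A) {ρ = ρ} {σ = σ} (0# ∷ L) (λ _ → letter-≋) _)
        (reflects⇐ (A-rec (cover s cov)) Pρ))
    where
    letter-≋ : ∀ {x} → letter ρ x ≡ letter σ x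
    letter-≋ = letter-cong {ρ = ρ} {σ = σ} (λ j → mk⇔ (proj₁ (ρ≋σ j)) (proj₂ (ρ≋σ j)))

  -- Boolean operations.

  definable-¬ : {P : Vector FinSet n → Set p} → Definable P → Definable (λ ρ → ¬ P ρ)
  definable-¬ (A , A-rec) = record { Automaton A ; final = not ∘ Automaton.final A }
                          , λ cov → ¬-reflects (A-rec cov)

  -- The product automaton, with an arbitrary Boolean combination of the two verdicts.
  module Pairing (A B : Automaton n) (_⊕_ : Bool → Bool → Bool) where
    module A = Automaton A
    module B = Automaton B

    left : Fin (A.states * B.states) → Fin A.states
    left q = proj₁ (remQuot B.states q)

    right : Fin (A.states * B.states) → Fin B.states
    right q = proj₂ (remQuot {A.states} B.states q)

    left-combine : ∀ (q : Fin A.states) (s : Fin B.states) → left (combine q s) ≡ q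
    left-combine q s = cong proj₁ (remQuot-combine q s)

    right-combine : ∀ (q : Fin A.states) (s : Fin B.states) → right (combine q s) ≡ s
    right-combine q s = cong proj₂ (remQuot-combine q s)

    pairing : Automaton n
    pairing = record
      { start = combine A.start B.start
      ; step  = λ a q → combine (A.step a (left q)) (B.step a (right q))
      ; final = λ q → A.final (left q) ⊕ B.final (right q)
      }

    step-pairing : ∀ a q s → Automaton.step pairing a (combine q s) ≡ combine (A.step a q) (B.step a s)
    step-pairing a q s =
      cong₂ (λ q s → combine (A.step a q) (B.step a s)) (left-combine q s) (right-combine q s)

    run-pairing : ∀ q s L → run (Automaton.step pairing) ρ (combine q s) L ≡
                            combine (run A.step ρ q L) (run B.step ρ s L)
    run-pairing q s []      = refl
    run-pairing {ρ = ρ} q s (x ∷ L) = ≡-trans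
      (cong (λ t → run _ ρ t L) (step-pairing (letter ρ x) q s))
      (run-pairing _ _ L)

    accepts-pairing : ∀ L → accepts pairing ρ L ≡ (accepts A ρ L ⊕ accepts B ρ L)
    accepts-pairing {ρ = ρ} L = ≡-trans
      (cong (Automaton.final pairing) (run-pairing {ρ = ρ} A.start B.start (0# ∷ L)))
      (cong₂ (λ q s → A.final q ⊕ B.final s) (left-combine qᴬ qᴮ) (right-combine qᴬ qᴮ))
      where
      qᴬ = run A.step ρ A.start (0# ∷ L)
      qᴮ = run B.step ρ B.start (0# ∷ L)

  definable-× : {P : Vector FinSet n → Set p} {R : Vector FinSet n → Set r} →
                Definable P → Definable R → Definable (λ ρ → P ρ × R ρ)
  definable-× (A , A-rec) (B , B-rec) = pairing , λ {ρ} {L} cov →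
    subst (Reflects _) (≡-sym (accepts-pairing L)) (A-rec cov ×-reflects B-rec cov)
    where open Pairing A B _∧_

  definable-⊎ : {P : Vector FinSet n → Set p} {R : Vector FinSet n → Set r} →
                Definable P → Definable R → Definable (λ ρ → P ρ ⊎ R ρ)
  definable-⊎ (A , A-rec) (B , B-rec) = pairing , λ {ρ} {L} cov →
    subst (Reflects _) (≡-sym (accepts-pairing L)) (A-rec cov ⊎-reflects B-rec cov)
    where open Pairing A B _∨_

  definable-→ : {P : Vector FinSet n → Set p} {R : Vector FinSet n → Set r} →
                Definable P → Definable R → Definable (λ ρ → P ρ → R ρ)
  definable-→ (A , A-rec) (B , B-rec) = pairing , λ {ρ} {L} cov →
    subst (Reflects _) (≡-sym (accepts-pairing L)) (A-rec cov →-reflects B-rec cov)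
    where open Pairing A B (λ a b → not a ∨ b)

  -- Projection and the quantifiers.

  between : Sorted w L → ∃[ z ] w < z × Sorted z L
  between {w} [-] with unbounded w
  ... | z , w<z = z , w<z , [-]
  between (w<y ∷ s) with dense w<y
  ... | z , w<z , z<y = z , w<z , z<y ∷ s

  module ProjectionCorrect (A : Automaton (suc n)) where
    open Automaton A
    open Projection A

    Closed : Fin (2 ^ states) → Set
    Closed S = ∀ {p q} → S ∋ p → Skip p q → S ∋ q

    -- Every `Step` ends with a sequence of skips, which absorbs one more.
    closed-step : ∀ a S → Closed (encode (step? a S))
    closed-step a S {p} p∈ pq with to (∋-encode (step? a S)) p∈
    ... | s , s∈S , b , sp = from (∋-encode (step? a S)) (s , s∈S , b , sp ◅◅ (pq ◅ ε))

    -- A point of `L⁺` outside `L` has a blank letter, so reading it is a skip and the state remains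
    -- in the closed set `S`. A point common to both lists is a step of the projection with no skips
    -- after it.
    simulate : ∀ {X S q} → Closed S → S ∋ q → Covers w ρ L → L ⊑ L⁺ → Sorted w L⁺ →
      run (Automaton.step projection) ρ S L ∋ run step (X Vector.∷ ρ) q L⁺
    simulate closed q∈S cov [] s = q∈S
    simulate {ρ = ρ} {X = X} {q = q} closed q∈S cov (z ∷ʳ L⊑L⁺) (w<z ∷ s) =
      simulate {X = X} closed
        (closed q∈S (does (z ∈? X) , cong (λ a → step (does (z ∈? X) ∷ a) q) (≡-sym z-blank)))
        (λ j x∈ z<x → cov j x∈ (trans w<z z<x)) L⊑L⁺ s
      where
      z-blank : letter ρ z ≡ blank
      z-blank = uncovered-blank {ρ = ρ} cov w<z (self-∉ s ∘ ⊑⇒⊆ L⊑L⁺)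
    simulate {ρ = ρ} {X = X} {S = S} {q = q} closed q∈S cov (_∷_ {z} refl L⊑L⁺) (w<z ∷ s) =
      simulate {ρ = ρ} {X = X} (closed-step (letter ρ z) S)
        (from (∋-encode (step? (letter ρ z) S)) (q , q∈S , does (z ∈? X) , ε))
        (covers-tail {ρ = ρ} cov w<z) L⊑L⁺ s

    -- The guess stays within `points`, hence above `w`. Earlier points can then be put in or left
    -- out without disturbing the run already found.
    record Realisable (ρ : Vector FinSet n) (w : Carrier) (L : List Carrier) (q q′ : Fin states) :
      Set (c ⊔ ℓ₁ ⊔ ℓ₂) where
      constructor realise
      field
        {points} : List Carrier
        guess    : FinSet
        sorted   : Sorted w points
        L⊆points : L ⊆ points
        guess⊆   : guess ⊆ points
        run≡     : run step (guess Vector.∷ ρ) q points ≡ q′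

    -- Adding `z` to the guess changes the letter at `z` alone, because `z` lies strictly below all
    -- of `L`; without it, `X ⊆ L` keeps `z` out.
    guessFirst : ∀ {X} b → X ⊆ L → Sorted z L →
      ∃[ X′ ] X′ ⊆ z ∷ L × (∀ q → run step (X′ Vector.∷ ρ) q (z ∷ L) ≡
                                  run step (X Vector.∷ ρ) (step (b ∷ letter ρ z) q) L)
    guessFirst {L = L} {z = z} {ρ = ρ} {X = X} true X⊆L s = z ∷ X
      , (λ { (here x≈z) → here x≈z ; (there x∈X) → there (X⊆L x∈X) })
      , λ q → ≡-trans
          (run-cong step {ρ = (z ∷ X) Vector.∷ ρ} {σ = X Vector.∷ ρ} L
            (λ {x} x∈L → cong (_∷ letter ρ x) (does-⇔ (mk⇔
              (λ { (here x≈z) → contradiction (∈-resp-≈ L x≈z x∈L) (self-∉ s)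
                 ; (there x∈X) → x∈X }) there) (x ∈? z ∷ X) (x ∈? X))) _)
          (cong (λ b → run step (X Vector.∷ ρ) (step (b ∷ letter ρ z) q) L)
            (dec-true (z ∈? z ∷ X) (here Eq.refl)))
    guessFirst {L = L} {z = z} {ρ = ρ} {X = X} false X⊆L s = X
      , there ∘ X⊆L
      , λ q → cong (λ b → run step (X Vector.∷ ρ) (step (b ∷ letter ρ z) q) L)
                (dec-false (z ∈? X) (self-∉ s ∘ X⊆L))

    realise-first : ∀ {q q′} b → w < z → Realisable ρ z L (step (b ∷ letter ρ z) q) q′ →
      Realisable ρ w (z ∷ L) q q′
    realise-first {ρ = ρ} b w<z (realise X s L⊆ X⊆ eq) with guessFirst {ρ = ρ} b X⊆ s
    ... | X′ , X′⊆ , eq′ = realise X′ (w<z ∷ s)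
      (λ { (here x≈z) → here x≈z ; (there x∈L) → there (L⊆ x∈L) }) X′⊆ (≡-trans (eq′ _) eq)

    -- The skips are realised from the last to the first. Density, or unboundedness if no points are
    -- listed yet, makes room for a new point right after `w`. It is absent from the cover, so it
    -- lies in no member of `ρ` and its letter is blank.
    realise-star : ∀ {p q q′} → Covers w ρ L → Star Skip p q → Realisable ρ w L q q′ → Realisable ρ w L p q′
    realise-star cov ε r = r
    realise-star {ρ = ρ} cov (_◅_ {p} (b , refl) rq) r with realise-star {ρ = ρ} cov rq r
    ... | realise {points = L⁺} X s L⊆ X⊆ eq with between s
    ...   | z , w<z , s′ with realise-first {ρ = ρ} {q = p} b w<z
              (realise X s′ L⊆ X⊆ (≡-trans (cong (λ a → run step (X Vector.∷ ρ) (step (b ∷ a) p) L⁺)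
                (uncovered-blank {ρ = ρ} cov w<z (self-∉ s′ ∘ L⊆))) eq))
    ...     | realise X′ s″ L⊆′ X′⊆ eq′ = realise X′ s″ (L⊆′ ∘ there) X′⊆ eq′

    -- The run of the projection is decoded backwards from `q′`. A state in the set after a letter
    -- comes from a state in the set before it by a guessed bit and some skips, and these skips
    -- become points directly after that letter.
    trace : ∀ {S q′} L → Covers w ρ L → Sorted w L →
      run (Automaton.step projection) ρ S L ∋ q′ → ∃[ q ] S ∋ q × Realisable ρ w L q q′
    trace [] cov s q∈S = _ , q∈S , realise [] [-] (λ ()) (λ ()) refl
    trace {ρ = ρ} {S = S} (z ∷ L) cov (w<z ∷ s) q′∈
      with trace {ρ = ρ} L (covers-tail {ρ = ρ} cov w<z) s q′∈
    ... | p , p∈ , r with to (∋-encode (step? (letter ρ z) S)) p∈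
    ...   | q , q∈S , b , qp = q , q∈S ,
            realise-first {ρ = ρ} b w<z (realise-star {ρ = ρ} (covers-tail {ρ = ρ} cov w<z) qp r)

    recognises-∃ : {P : Vector FinSet (suc n) → Set p} → Recognises A P →
      Recognises projection (λ ρ → Σ[ X ∈ FinSet ] P (X Vector.∷ ρ))
    recognises-∃ {P = P} A-rec {ρ} {L} cov@(cover s covs) = fromEquivalence sound complete
      where
      start∈ : encode (Fin._≟ start) ∋ start
      start∈ = from (∋-encode (Fin._≟ start)) refl

      S₀ S : Fin (2 ^ states)
      S₀ = encode (Fin._≟ start)
      S = run (Automaton.step projection) ρ S₀ (0# ∷ L)

      complete : Σ[ X ∈ FinSet ] P (X Vector.∷ ρ) → T (accepts projection ρ L)
      complete (X , PX) with extendCover cov X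
      ... | L⁺ , L⊑L⁺ , cov⁺@(cover s⁺ _) = subst T (≡-sym (dec-true (final? S)
        (_ , simulate {ρ = ρ} {X = X} (closed-step (letter ρ 0#) S₀)
               (from (∋-encode (step? (letter ρ 0#) S₀)) (start , start∈ , does (0# ∈? X) , ε))
               covs L⊑L⁺ s⁺
           , reflects⇐ (A-rec cov⁺) PX))) _

      sound : T (accepts projection ρ L) → Σ[ X ∈ FinSet ] P (X Vector.∷ ρ)
      sound acc with final? S
      ... | yes (q′ , q′∈ , q′-final) with trace {ρ = ρ} L covs s q′∈
      ...   | p , p∈ , r with to (∋-encode (step? (letter ρ 0#) S₀)) p∈
      ...     | q , q∈ , b , qp with to (∋-encode (Fin._≟ start)) q∈ | realise-star {ρ = ρ} covs qp r
      ...       | refl | realise X s⁺ L⊆ X⊆ refl with guessFirst {ρ = ρ} b X⊆ s⁺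
      -- The bit guessed with the first letter decides whether `0#` itself belongs to the witness.
      ...         | X′ , X′⊆ , eq′ = X′ , reflects⇒ (A-rec (cover s⁺ covs⁺)) (subst (T ∘ final) (≡-sym (eq′ _)) q′-final)
        where
        covs⁺ : Covers 0# (X′ Vector.∷ ρ) _
        covs⁺ zero x∈ 0<x with X′⊆ x∈
        ... | here x≈0  = contradiction 0<x (irrefl (Eq.sym x≈0))
        ... | there x∈L = x∈L
        covs⁺ (suc j) x∈ 0<x = L⊆ (covs j x∈ 0<x)

  definable-∃ : {P : Vector FinSet (suc n) → Set p} → Definable P →
                Definable (λ ρ → Σ[ X ∈ FinSet ] P (X Vector.∷ ρ))
  definable-∃ (A , A-rec) = Projection.projection A , ProjectionCorrect.recognises-∃ A A-rec

  definable-∀ : {P : Vector FinSet (suc n) → Set p} → Definable P →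
                Definable (λ ρ → (X : FinSet) → P (X Vector.∷ ρ))
  definable-∀ P-def = definable-⇔
    (λ ρ → mk⇔ (λ ¬∃¬ X → decidable-stable (definable? P-def _) (λ ¬PX → ¬∃¬ (X , ¬PX)))
               (λ ∀P (X , ¬PX) → ¬PX (∀P X)))
    (definable-¬ (definable-∃ (definable-¬ P-def)))

  -- Atomic relations and quantification over points.

  record Meets {n} (i j : Fin n) (ρ : Vector FinSet n) : Set (c ⊔ ℓ₁ ⊔ ℓ₂) where
    constructor meets
    field
      {point} : Carrier
      ∈ˡ      : point ∈ ρ i
      ∈ʳ      : point ∈ ρ j

  record Less {n} (i j : Fin n) (ρ : Vector FinSet n) : Set (c ⊔ ℓ₁ ⊔ ℓ₂) where
    constructor less
    field
      {lower upper} : Carrier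
      ∈ˡ            : lower ∈ ρ i
      ∈ʳ            : upper ∈ ρ j
      lower<upper   : lower < upper

  -- No point lies below `0#`, so what a cover does not list can only be `0#` itself.
  cover-∈ : ∀ {j} → Cover ρ L → x ∈ ρ j → x ∈ 0# ∷ L
  cover-∈ {x = x} (cover _ covs) x∈ with compare 0# x
  ... | tri< 0<x _ _ = there (covs _ x∈ 0<x)
  ... | tri≈ _ 0≈x _ = here (Eq.sym 0≈x)
  ... | tri> _ _ x<0 = contradiction x<0 (0-least x)

  reflects-⇔ : ∀ {P : Set p} {R : Set r} {b} → Reflects P b → P ⇔ R → Reflects R b
  reflects-⇔ P-refl P⇔R = fromEquivalence (to P⇔R ∘ reflects⇒ P-refl) (reflects⇐ P-refl ∘ from P⇔R)

  lookup-letter : ∀ (ρ : Vector FinSet n) x i → Vec.lookup (letter ρ x) i ≡ does (x ∈? ρ i)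
  lookup-letter ρ x = lookup∘tabulate (λ j → does (x ∈? ρ j))

  definable-Meets : (i j : Fin n) → Definable (Meets i j)
  definable-Meets {n} i j = record { start = zero ; step = δ ; final = accepting } , λ {ρ} {L} cov →
    reflects-⇔ (meets-reflects ρ (0# ∷ L)) (mk⇔
      (λ (x , x∈i , x∈j , _) → meets x∈i x∈j)
      (λ { (meets x∈i x∈j) → _ , x∈i , x∈j , cover-∈ {ρ = ρ} cov x∈i }))
    where
    -- State one remembers that a common point has been read.
    δ : Vec Bool n → Fin 2 → Fin 2
    δ a zero       = bit (Vec.lookup a i ∧ Vec.lookup a j)
    δ a (suc zero) = suc zero

    accepting : Fin 2 → Bool
    accepting zero       = false
    accepting (suc zero) = true

    run-stays : ∀ ρ L → run δ ρ (suc zero) L ≡ suc zero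
    run-stays ρ []      = refl
    run-stays ρ (_ ∷ L) = run-stays ρ L

    meets-reflects : ∀ ρ L → Reflects (∃[ x ] x ∈ ρ i × x ∈ ρ j × x ∈ L) (accepting (run δ ρ zero L))
    meets-reflects ρ []      = ofⁿ λ ()
    meets-reflects ρ (z ∷ L) rewrite lookup-letter ρ z i | lookup-letter ρ z j with z ∈? ρ i | z ∈? ρ j
    ... | yes z∈i | yes z∈j rewrite run-stays ρ L = ofʸ (z , z∈i , z∈j , here Eq.refl)
    ... | no  z∉i | _       = reflects-⇔ (meets-reflects ρ L) (mk⇔
      (λ (x , x∈i , x∈j , x∈L) → x , x∈i , x∈j , there x∈L)
      (λ { (x , x∈i , x∈j , here x≈z)  → contradiction (∈-resp-≈ (ρ i) x≈z x∈i) z∉i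
         ; (x , x∈i , x∈j , there x∈L) → x , x∈i , x∈j , x∈L }))
    ... | yes _   | no  z∉j = reflects-⇔ (meets-reflects ρ L) (mk⇔
      (λ (x , x∈i , x∈j , x∈L) → x , x∈i , x∈j , there x∈L)
      (λ { (x , x∈i , x∈j , here x≈z)  → contradiction (∈-resp-≈ (ρ j) x≈z x∈j) z∉j
         ; (x , x∈i , x∈j , there x∈L) → x , x∈i , x∈j , x∈L }))

  definable-Less : (i j : Fin n) → Definable (Less i j)
  definable-Less {n} i j = record { start = zero ; step = δ ; final = accepting } , λ {ρ} {L} cov →
    reflects-⇔ (less-reflects ρ (0# ∷ L) (Cover.sorted cov)) (mk⇔
      (λ (x , y , x∈i , y∈j , _ , _ , x<y) → less x∈i y∈j x<y)
      (λ { (less x∈i y∈j x<y) →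
             _ , _ , x∈i , y∈j , cover-∈ {ρ = ρ} cov x∈i , cover-∈ {ρ = ρ} cov y∈j , x<y }))
    where
    -- State one: a point of `ρ i` has been read. State two: a strictly later point of `ρ j` has
    -- been read as well.
    δ : Vec Bool n → Fin 3 → Fin 3
    δ a zero             = if Vec.lookup a i then suc zero else zero
    δ a (suc zero)       = if Vec.lookup a j then suc (suc zero) else suc zero
    δ a (suc (suc zero)) = suc (suc zero)

    accepting : Fin 3 → Bool
    accepting zero             = false
    accepting (suc zero)       = false
    accepting (suc (suc zero)) = true

    run-stays : ∀ ρ L → run δ ρ (suc (suc zero)) L ≡ suc (suc zero)
    run-stays ρ []      = refl
    run-stays ρ (_ ∷ L) = run-stays ρ L

    upper-reflects : ∀ ρ L → Reflects (∃[ y ] y ∈ ρ j × y ∈ L) (accepting (run δ ρ (suc zero) L))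
    upper-reflects ρ []      = ofⁿ λ ()
    upper-reflects ρ (z ∷ L) rewrite lookup-letter ρ z j with z ∈? ρ j
    ... | yes z∈j rewrite run-stays ρ L = ofʸ (z , z∈j , here Eq.refl)
    ... | no  z∉j = reflects-⇔ (upper-reflects ρ L) (mk⇔
      (λ (y , y∈j , y∈L) → y , y∈j , there y∈L)
      (λ { (y , y∈j , here y≈z)  → contradiction (∈-resp-≈ (ρ j) y≈z y∈j) z∉j
         ; (y , y∈j , there y∈L) → y , y∈j , y∈L }))

    later : ∀ {x y z L} → Sorted z L → x ∈ z ∷ L → y ∈ z ∷ L → x < y → y ∈ L
    later s _           (there y∈L) _   = y∈L
    later s (here x≈z)  (here y≈z)  x<y = contradiction x<y (irrefl (Eq.trans x≈z (Eq.sym y≈z)))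
    later s (there x∈L) (here y≈z)  x<y = contradiction (<-respʳ-≈ y≈z x<y) (asym (above s x∈L))

    less-reflects : ∀ ρ L → Linked _<_ L →
      Reflects (∃[ x ] ∃[ y ] x ∈ ρ i × y ∈ ρ j × x ∈ L × y ∈ L × x < y) (accepting (run δ ρ zero L))
    less-reflects ρ []      s = ofⁿ λ ()
    less-reflects ρ (z ∷ L) s rewrite lookup-letter ρ z i with z ∈? ρ i
    -- The first point of `ρ i` can serve as the lower point of any pair, so only a later point of
    -- `ρ j` remains to be found.
    ... | yes z∈i = reflects-⇔ (upper-reflects ρ L) (mk⇔
      (λ (y , y∈j , y∈L) → z , y , z∈i , y∈j , here Eq.refl , there y∈L , above s y∈L)
      (λ (x , y , _ , y∈j , x∈ , y∈ , x<y) → y , y∈j , later s x∈ y∈ x<y))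
    ... | no z∉i = reflects-⇔ (less-reflects ρ L (Linked.tail s)) (mk⇔
      (λ (x , y , x∈i , y∈j , x∈L , y∈L , x<y) → x , y , x∈i , y∈j , there x∈L , there y∈L , x<y)
      (λ { (x , y , x∈i , y∈j , here x≈z , _ , x<y)    → contradiction (∈-resp-≈ (ρ i) x≈z x∈i) z∉i
         ; (x , y , x∈i , y∈j , there x∈L , y∈ , x<y) →
             x , y , x∈i , y∈j , x∈L , later s (there x∈L) y∈ x<y , x<y }))

  ≋-refl : X ≋ X
  ≋-refl = (λ x∈ → x∈) , (λ x∈ → x∈)

  -- Variables ranging over points are represented by singletons.
  ∃¹ : (Vector FinSet (suc n) → Set p) → Vector FinSet n → Set _
  ∃¹ P ρ = ∃[ a ] P ([ a ] Vector.∷ ρ)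

  -- A singleton is a set that meets itself, so is nonempty, and contains no two points one below
  -- the other.
  definable-singleton : (i : Fin n) → Definable (λ ρ → ∃[ a ] ρ i ≋ [ a ])
  definable-singleton i = definable-⇔
    (λ ρ → mk⇔
      (λ (nonempty , ¬less) → Meets.point nonempty ,
        (λ {_} x∈ → here (≮∧≯⇒≈ (λ x<a → ¬less (less x∈ (Meets.∈ˡ nonempty) x<a))
                            (λ a<x → ¬less (less (Meets.∈ˡ nonempty) x∈ a<x)))) ,
        λ {_} x∈ → ∈-resp-≈ (ρ i) (Eq.sym (∈-[]⁻ x∈)) (Meets.∈ˡ nonempty))
      (λ (a , ⊆[a] , [a]⊆) → meets ([a]⊆ (here Eq.refl)) ([a]⊆ (here Eq.refl)) ,
        λ (less x∈ y∈ x<y) → irrefl (Eq.trans (∈-[]⁻ (⊆[a] x∈)) (Eq.sym (∈-[]⁻ (⊆[a] y∈)))) x<y))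
    (definable-× (definable-Meets i i) (definable-¬ (definable-Less i i)))

  -- Set quantification is relativised to singletons. The set found only has the same members as
  -- some `[ a ]`, and invariance of definable relations carries `P` over to `[ a ]`.
  definable-∃¹ : {P : Vector FinSet (suc n) → Set p} → Definable P → Definable (∃¹ P)
  definable-∃¹ P-def = definable-⇔
    (λ ρ → mk⇔
      (λ (X , (a , X≋[a]) , PX) → a , definable-resp-≋ P-def
        (λ { zero → X≋[a] ; (suc j) → ≋-refl }) PX)
      (λ (a , Pa) → [ a ] , (a , ≋-refl) , Pa))
    (definable-∃ (definable-× (definable-singleton zero) P-def))

  -- First-order formulas define recognisable relations.

  open Semantics (𝒲 I 0#)

  -- For τ i a singleton {a}, `Member t i θ τ` says that a lies in the value of t
  -- in the environment τ ∘ θ; the case of ⊥ᵗ is false because {a} meets itself.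
  Member : Term n → Fin m → (Fin n → Fin m) → Vector FinSet m → Set (c ⊔ ℓ₁ ⊔ ℓ₂)
  Member (var j)    i θ τ = Meets i (θ j) τ
  Member (t ∪ᵗ u)   i θ τ = Member t i θ τ ⊎ Member u i θ τ
  Member (t ∩ᵗ u)   i θ τ = Member t i θ τ × Member u i θ τ
  Member ⊥ᵗ         i θ τ = ¬ Meets i i τ
  Member c₀ᵗ        i θ τ = ¬ ∃¹ (Less zero (suc i)) τ
  Member (minᵗ t)   i θ τ =
    Member t i θ τ × ¬ ∃¹ (λ υ → Member t zero (suc ∘ θ) υ × Less zero (suc i) υ) τ
  Member (maxᵗ t)   i θ τ =
    Member t i θ τ × ¬ ∃¹ (λ υ → Member t zero (suc ∘ θ) υ × Less (suc i) zero υ) τ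
  Member (ipsᵗ t u) i θ τ =
    Member t i θ τ ×
    ∃¹ (λ υ → Member t zero (suc ∘ θ) υ × Member u zero (suc ∘ θ) υ × Less (suc i) zero υ ×
      -- No member of `t` lies strictly between the two points, so the upper one is the successor of
      -- the lower.
      ¬ ∃¹ (λ φ → Member t zero (λ j → suc (suc (θ j))) φ ×
                  Less (suc (suc i)) zero φ × Less zero (suc zero) φ) υ) τ

  definable-Member : ∀ t (i : Fin m) (θ : Fin n → Fin m) → Definable (Member t i θ)
  definable-Member (var j)    i θ = definable-Meets i (θ j)
  definable-Member (t ∪ᵗ u)   i θ = definable-⊎ (definable-Member t i θ) (definable-Member u i θ)
  definable-Member (t ∩ᵗ u)   i θ = definable-× (definable-Member t i θ) (definable-Member u i θ)
  definable-Member ⊥ᵗ         i θ = definable-¬ (definable-Meets i i)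
  definable-Member c₀ᵗ        i θ = definable-¬ (definable-∃¹ (definable-Less zero (suc i)))
  definable-Member (minᵗ t)   i θ = definable-× (definable-Member t i θ)
    (definable-¬ (definable-∃¹ (definable-× (definable-Member t zero (suc ∘ θ))
                                            (definable-Less zero (suc i)))))
  definable-Member (maxᵗ t)   i θ = definable-× (definable-Member t i θ)
    (definable-¬ (definable-∃¹ (definable-× (definable-Member t zero (suc ∘ θ))
                                            (definable-Less (suc i) zero))))
  definable-Member (ipsᵗ t u) i θ = definable-× (definable-Member t i θ)
    (definable-∃¹ (definable-× (definable-Member t zero (suc ∘ θ))
      (definable-× (definable-Member u zero (suc ∘ θ))
      (definable-× (definable-Less (suc i) zero)
        (definable-¬ (definable-∃¹ (definable-× (definable-Member t zero (λ j → suc (suc (θ j))))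
          (definable-× (definable-Less (suc (suc i)) zero) (definable-Less zero (suc zero))))))))))

  meets-point : ∀ {i j : Fin n} → ρ i ≡ [ x ] → Meets i j ρ ⇔ x ∈ ρ j
  meets-point {ρ = ρ} {i = i} {j} ρi≡ = mk⇔
    (λ (meets x∈i x∈j) → ∈-resp-≈ (ρ j) (∈-[]⁻ (subst (_ ∈_) ρi≡ x∈i)) x∈j)
    (λ x∈j → meets (subst (_ ∈_) (≡-sym ρi≡) (here Eq.refl)) x∈j)

  less-point : ∀ {i j : Fin n} → ρ i ≡ [ x ] → ρ j ≡ [ y ] → Less i j ρ ⇔ x < y
  less-point ρi≡ ρj≡ = mk⇔
    (λ (less x∈i y∈j x<y) → <-respˡ-≈ (∈-[]⁻ (subst (_ ∈_) ρi≡ x∈i))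
                              (<-respʳ-≈ (∈-[]⁻ (subst (_ ∈_) ρj≡ y∈j)) x<y))
    (λ x<y → less (subst (_ ∈_) (≡-sym ρi≡) (here Eq.refl))
                  (subst (_ ∈_) (≡-sym ρj≡) (here Eq.refl)) x<y)

  member-⇔ : ∀ t {i : Fin m} {θ : Fin n → Fin m} {τ a} → τ i ≡ [ a ] →
             Member t i θ τ ⇔ a ∈ ⟦ t ⟧ (τ ∘ θ)
  member-⇔ (var j) {θ = θ} {τ} τi≡ = meets-point {ρ = τ} {j = θ j} τi≡
  member-⇔ (t ∪ᵗ u) {θ = θ} {τ} τi≡ = mk⇔
    (λ { (inj₁ ∈t) → Membershipₚ.∈-++⁺ˡ Eq.setoid (to (member-⇔ t τi≡) ∈t)
       ; (inj₂ ∈u) → Membershipₚ.∈-++⁺ʳ Eq.setoid (⟦ t ⟧ (τ ∘ θ)) (to (member-⇔ u τi≡) ∈u) })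
    (λ a∈ → Sum.map (from (member-⇔ t τi≡)) (from (member-⇔ u τi≡))
              (Membershipₚ.∈-++⁻ Eq.setoid (⟦ t ⟧ (τ ∘ θ)) a∈))
  member-⇔ (t ∩ᵗ u) {θ = θ} {τ} τi≡ = mk⇔
    (λ (∈t , ∈u) → ∈-∩⁺ {B = ⟦ u ⟧ (τ ∘ θ)} (to (member-⇔ t τi≡) ∈t) (to (member-⇔ u τi≡) ∈u))
    (λ a∈ → Product.map (from (member-⇔ t τi≡)) (from (member-⇔ u τi≡)) (∈-∩⁻ a∈))
  member-⇔ ⊥ᵗ {i} {τ = τ} τi≡ = mk⇔
    (λ ¬meets → contradiction (from (meets-point {ρ = τ} {i = i} {i} τi≡)
                  (subst (_ ∈_) (≡-sym τi≡) (here Eq.refl))) ¬meets)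
    (λ ())
  member-⇔ c₀ᵗ {i} {τ = τ} {a} τi≡ = mk⇔
    (λ ¬below → here (≮∧≯⇒≈ (0-least a) (λ 0<a → ¬below (0# , from (less-0 0#) 0<a))))
    (λ a∈ (b , b<a) → 0-least b (<-respʳ-≈ (∈-[]⁻ a∈) (to (less-0 b) b<a)))
    where
    less-0 : ∀ b → Less zero (suc i) ([ b ] Vector.∷ τ) ⇔ b < a
    less-0 b = less-point {ρ = [ b ] Vector.∷ τ} refl τi≡
  member-⇔ (minᵗ t) {i} {θ} {τ} {a} τi≡ = mk⇔
    (λ (∈t , ¬below) → from (∈-min (⟦ t ⟧ (τ ∘ θ))) (to (member-⇔ t τi≡) ∈t ,
      λ {b} b∈ b<a → ¬below (b , from (member-⇔ t refl) b∈ , from (less-a b) b<a)))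
    (λ a∈ → let a∈t , a-min = to (∈-min (⟦ t ⟧ (τ ∘ θ))) a∈ in
      from (member-⇔ t τi≡) a∈t ,
      λ (b , b∈ , b<a) → a-min (to (member-⇔ t refl) b∈) (to (less-a b) b<a))
    where
    less-a : ∀ b → Less zero (suc i) ([ b ] Vector.∷ τ) ⇔ b < a
    less-a b = less-point {ρ = [ b ] Vector.∷ τ} refl τi≡
  member-⇔ (maxᵗ t) {i} {θ} {τ} {a} τi≡ = mk⇔
    (λ (∈t , ¬above) → from (∈-max (⟦ t ⟧ (τ ∘ θ))) (to (member-⇔ t τi≡) ∈t ,
      λ {b} b∈ a<b → ¬above (b , from (member-⇔ t refl) b∈ , from (a-less b) a<b)))
    (λ a∈ → let a∈t , a-max = to (∈-max (⟦ t ⟧ (τ ∘ θ))) a∈ in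
      from (member-⇔ t τi≡) a∈t ,
      λ (b , b∈ , a<b) → a-max (to (member-⇔ t refl) b∈) (to (a-less b) a<b))
    where
    a-less : ∀ b → Less (suc i) zero ([ b ] Vector.∷ τ) ⇔ a < b
    a-less b = less-point {ρ = [ b ] Vector.∷ τ} τi≡ refl
  member-⇔ (ipsᵗ t u) {i} {θ} {τ} {a} τi≡ = mk⇔
    (λ (∈t , b , b∈t , b∈u , a<b , ¬between) →
      from (∈-ips (⟦ t ⟧ (τ ∘ θ)) (⟦ u ⟧ (τ ∘ θ))) (to (member-⇔ t τi≡) ∈t ,
        b , isSuccessor (to (member-⇔ t refl) b∈t) (to (a-less b) a<b)
              (λ {z} z∈t a<z z<b → ¬between (z , from (member-⇔ t refl) z∈t ,
                                             from (a-less′ z b) a<z , from (less-b z b) z<b))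
          , to (member-⇔ u refl) b∈u))
    (λ a∈ → let a∈t , b , isSuccessor b∈t a<b closest , b∈u =
                  to (∈-ips (⟦ t ⟧ (τ ∘ θ)) (⟦ u ⟧ (τ ∘ θ))) a∈ in
      from (member-⇔ t τi≡) a∈t , b , from (member-⇔ t refl) b∈t , from (member-⇔ u refl) b∈u ,
      from (a-less b) a<b ,
      λ (z , z∈t , a<z , z<b) → closest (to (member-⇔ t refl) z∈t) (to (a-less′ z b) a<z) (to (less-b z b) z<b))
    where
    a-less : ∀ b → Less (suc i) zero ([ b ] Vector.∷ τ) ⇔ a < b
    a-less b = less-point {ρ = [ b ] Vector.∷ τ} τi≡ refl
    a-less′ : ∀ z b → Less (suc (suc i)) zero ([ z ] Vector.∷ [ b ] Vector.∷ τ) ⇔ a < z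
    a-less′ z b = less-point {ρ = [ z ] Vector.∷ [ b ] Vector.∷ τ} τi≡ refl
    less-b : ∀ z b → Less zero (suc zero) ([ z ] Vector.∷ [ b ] Vector.∷ τ) ⇔ z < b
    less-b z b = less-point {ρ = [ z ] Vector.∷ [ b ] Vector.∷ τ} refl refl

  -- Inclusion means that no point is a counterexample; decidable membership turns this back into an
  -- inclusion.
  definable-⊆ : (t u : Term n) → Definable (λ ρ → ⟦ t ⟧ ρ ⊆ ⟦ u ⟧ ρ)
  definable-⊆ t u = definable-⇔
    (λ ρ → mk⇔
      (λ ¬∃ {x} x∈t → decidable-stable (x ∈? ⟦ u ⟧ ρ) (λ x∉u →
        ¬∃ (x , from (member-⇔ t refl) x∈t , x∉u ∘ to (member-⇔ u refl))))
      (λ t⊆u (x , x∈t , x∉u) → x∉u (from (member-⇔ u refl) (t⊆u (to (member-⇔ t refl) x∈t)))))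
    (definable-¬ (definable-∃¹ (definable-× (definable-Member t zero suc)
                                            (definable-¬ (definable-Member u zero suc)))))

  definable-⊨ : (φ : Formula n) → Definable (_⊨ φ)
  definable-⊨ (t ≐ u)  = definable-× (definable-⊆ t u) (definable-⊆ u t)
  definable-⊨ (¬ᶠ φ)   = definable-¬ (definable-⊨ φ)
  definable-⊨ (φ ∧ᶠ ψ) = definable-× (definable-⊨ φ) (definable-⊨ ψ)
  definable-⊨ (φ ∨ᶠ ψ) = definable-⊎ (definable-⊨ φ) (definable-⊨ ψ)
  definable-⊨ (φ ⇒ᶠ ψ) = definable-→ (definable-⊨ φ) (definable-⊨ ψ)
  definable-⊨ (∃ᶠ φ)   = definable-∃ (definable-⊨ φ)
  definable-⊨ (∀ᶠ φ)   = definable-∀ (definable-⊨ φ)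

  -- Semantics of the formula combinators.

  ⊑ᵗ-⇔ : ∀ {τ : Vector FinSet n} t u → (τ ⊨ t ⊑ᵗ u) ⇔ (⟦ t ⟧ τ ⊆ ⟦ u ⟧ τ)
  ⊑ᵗ-⇔ {τ = τ} t u = mk⇔ sound complete
    where
    sound : τ ⊨ t ⊑ᵗ u → ⟦ t ⟧ τ ⊆ ⟦ u ⟧ τ
    sound (t∪u⊆u , _) x∈t = t∪u⊆u (Membershipₚ.∈-++⁺ˡ Eq.setoid x∈t)

    t∪u⊆u : ⟦ t ⟧ τ ⊆ ⟦ u ⟧ τ → ⟦ t ∪ᵗ u ⟧ τ ⊆ ⟦ u ⟧ τ
    t∪u⊆u t⊆u x∈ = Sum.[ t⊆u , id ] (Membershipₚ.∈-++⁻ Eq.setoid (⟦ t ⟧ τ) x∈)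

    complete : ⟦ t ⟧ τ ⊆ ⟦ u ⟧ τ → τ ⊨ t ⊑ᵗ u
    complete t⊆u = t∪u⊆u t⊆u , Membershipₚ.∈-++⁺ʳ Eq.setoid (⟦ t ⟧ τ)

  ⋀-⇔ : ∀ {a} {A : Set a} {τ : Vector FinSet n} {φ : A → Formula n} {xs} → (∀ x → x ∈ₚ xs) →
        (τ ⊨ ⋀ xs φ) ⇔ (∀ x → τ ⊨ φ x)
  ⋀-⇔ {A = A} {τ = τ} {φ} {xs} all = mk⇔ (λ ⊨⋀ x → elim (all x) ⊨⋀) (intro xs)
    where
    elim : ∀ {x xs} → x ∈ₚ xs → τ ⊨ ⋀ xs φ → τ ⊨ φ x
    elim (here refl) (⊨φ , _)  = ⊨φ
    elim (there x∈)  (_ , ⊨⋀) = elim x∈ ⊨⋀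
    intro : ∀ xs → (∀ x → τ ⊨ φ x) → τ ⊨ ⋀ xs φ
    intro []       ⊨φ = ≋-refl
    intro (x ∷ xs) ⊨φ = ⊨φ x , intro xs ⊨φ

  ∃ⁿ-⇔ : ∀ k {ρ : Vector FinSet n} {φ : Formula (k + n)} →
         (ρ ⊨ ∃ⁿ k φ) ⇔ (Σ[ Xs ∈ Vec FinSet k ] (extend Xs ρ ⊨ φ))
  ∃ⁿ-⇔ zero    = mk⇔ (λ ⊨φ → [] , ⊨φ) (λ { ([] , ⊨φ) → ⊨φ })
  ∃ⁿ-⇔ (suc k) {ρ} {φ} = mk⇔
    (λ ⊨φ → let Xs , X , ⊨φ′ = to (∃ⁿ-⇔ k {ρ} {∃ᶠ φ}) ⊨φ in X ∷ Xs , ⊨φ′)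
    (λ { (X ∷ Xs , ⊨φ) → from (∃ⁿ-⇔ k {ρ} {∃ᶠ φ}) (Xs , X , ⊨φ) })

  -- Certificates of acceptance.

  isSuccessor-unique : ∀ {A} → IsSuccessor A x y → IsSuccessor A x z → y ≈ z
  isSuccessor-unique (isSuccessor y∈A x<y y-closest) (isSuccessor z∈A x<z z-closest) =
    ≮∧≯⇒≈ (z-closest y∈A x<y) (y-closest z∈A x<z)

  module _ (A : Automaton n) (ρ : Vector FinSet n) where

    open Automaton A

    -- This is the semantic content of the description, with letters and complements evaluated. The
    -- sets `Q q` may overlap or contain points off the run.
    record Certificate (U : FinSet) (Q : Fin states → FinSet) : Set (c ⊔ ℓ₁ ⊔ ℓ₂) where
      field
        0∈U   : 0# ∈ U
        ρ⊆U   : ∀ j → ρ j ⊆ U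
        first : 0# ∈ Q (step (letter ρ 0#) start)
        next  : ∀ {q x y} → x ∈ Q q → x ∈ U → IsSuccessor U x y → y ∈ Q (step (letter ρ y) q)
        last  : ∀ {q x} → x ∈ Q q → IsGreatest U x → T (final q)

    certificate-cong : ∀ {U U′ Q Q′} → U ≡ U′ → (∀ q → Q q ≡ Q′ q) → Certificate U Q → Certificate U′ Q′
    certificate-cong refl Q≡ certificate = record
      { 0∈U   = 0∈U
      ; ρ⊆U   = ρ⊆U
      ; first = subst (_ ∈_) (Q≡ _) first
      ; next  = λ x∈Q x∈U x-next → subst (_ ∈_) (Q≡ _) (next (subst (_ ∈_) (≡-sym (Q≡ _)) x∈Q) x∈U x-next)
      ; last  = λ x∈Q → last (subst (_ ∈_) (≡-sym (Q≡ _)) x∈Q)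
      }
      where open Certificate certificate

    module _ {U Q} (certificate : Certificate U Q) where
      open Certificate certificate

      -- The hypotheses make `L` the increasing list of the points of `U` above `x`. Its head is the
      -- successor of `x` in `U`, so `next` carries the state along; when `L` is empty, `x` is the
      -- maximum of `U` and `last` applies.
      final-run : ∀ {q} → Sorted x L → x ∈ U → x ∈ Q q → (∀ {y} → y ∈ U → x < y → y ∈ L) → L ⊆ U →
                  T (final (run step ρ q L))
      final-run {L = []} s x∈U x∈Q U⊆L L⊆U = last x∈Q (x∈U , λ y∈U x<y → contradiction (U⊆L y∈U x<y) λ ())
      final-run {x} {L = y ∷ L} (x<y ∷ s) x∈U x∈Q U⊆L L⊆U =
        final-run s y∈U (next x∈Q x∈U (isSuccessor y∈U x<y closest)) later (L⊆U ∘ there)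
        where
        y∈U : y ∈ U
        y∈U = L⊆U (here Eq.refl)
        closest : ∀ {z} → z ∈ U → x < z → ¬ (z < y)
        closest z∈U x<z z<y with U⊆L z∈U x<z
        ... | here z≈y  = irrefl z≈y z<y
        ... | there z∈L = asym (above s z∈L) z<y
        later : ∀ {z} → z ∈ U → y < z → z ∈ L
        later z∈U y<z with U⊆L z∈U (trans x<y y<z)
        ... | here z≈y  = contradiction y<z (irrefl (Eq.sym z≈y))
        ... | there z∈L = z∈L

      certificate-sound : ∃[ L ] Cover ρ L × T (accepts A ρ L)
      certificate-sound with insertAll U [-]
      -- `insertAll` sorts the points of `U` above `0#`, but its specification does not exclude
      -- other points; filtering by `U` does.
      ... | L , _ , s , U⊆L = filter (_∈? U) L
        , cover s′ (λ j x∈ 0<x → ∈-∩⁺ (U⊆L (ρ⊆U j x∈) 0<x) (ρ⊆U j x∈))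
        , final-run s′ 0∈U first
            (λ y∈U 0<y → ∈-∩⁺ (U⊆L y∈U 0<y) y∈U)
            (λ x∈ → proj₂ (∈-∩⁻ {A = L} x∈))
        where
        s′ : Sorted 0# (filter (_∈? U) L)
        s′ = subst (Linked _<_) (filter-accept (_∈? U) 0∈U) (Linkedₚ.filter⁺ (_∈? U) trans s)

    -- The run started in the first state is in the second one just after the letter at the given
    -- point has been read.
    data Visit : Fin states → List Carrier → Carrier → Fin states → Set (c ⊔ ℓ₁) where
      now   : ∀ {q} → x ≈ z → Visit q (z ∷ L) x (step (letter ρ z) q)
      later : ∀ {q s} → Visit (step (letter ρ z) q) L x s → Visit q (z ∷ L) x s

    visits : Fin states → Fin states → List Carrier → FinSet
    visits s q []      = []
    visits s q (z ∷ L) = if does (step (letter ρ z) q Fin.≟ s) then z ∷ rest else rest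
      where rest = visits s (step (letter ρ z) q) L

    ∈-visits : ∀ {s} q L → x ∈ visits s q L ⇔ Visit q L x s
    ∈-visits q []      = mk⇔ (λ ()) (λ ())
    ∈-visits {s = s} q (z ∷ L) with step (letter ρ z) q Fin.≟ s
    ... | yes refl = mk⇔
      (λ { (here x≈z) → now x≈z ; (there x∈) → later (to (∈-visits _ L) x∈) })
      (λ { (now x≈z) → here x≈z ; (later v) → there (from (∈-visits _ L) v) })
    ... | no ≢s = mk⇔
      (λ x∈ → later (to (∈-visits _ L) x∈))
      (λ { (now x≈z) → contradiction refl ≢s ; (later v) → from (∈-visits _ L) v })

    visit-∈ : ∀ {q s} → Visit q L x s → x ∈ L
    visit-∈ (now x≈z) = here x≈z
    visit-∈ (later v) = there (visit-∈ v)

    -- In a sorted list the successor of an entry is the next entry; any other position of `y`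
    -- contradicts the order or the choice of `y` as closest.
    visit-next : ∀ {q s} → Linked _<_ L → Visit q L x s → IsSuccessor L x y →
                 Visit q L y (step (letter ρ y) s)
    visit-next _ (now x≈z) (isSuccessor (here y≈z) x<y _) =
      contradiction x<y (irrefl (Eq.trans x≈z (Eq.sym y≈z)))
    visit-next _ (now _) (isSuccessor (there (here y≈w)) x<y _) =
      subst (λ a → Visit _ _ _ (step a _)) (≡-sym (letter-resp-≈ {ρ = ρ} y≈w)) (later (now y≈w))
    visit-next (z<w ∷ s) (now x≈z) (isSuccessor (there (there y∈L)) x<y closest) =
      contradiction (above s y∈L) (closest (there (here Eq.refl)) (<-respˡ-≈ (Eq.sym x≈z) z<w))
    visit-next s (later v) (isSuccessor (here y≈z) x<y _) =
      contradiction (<-respʳ-≈ y≈z x<y) (asym (above s (visit-∈ v)))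
    visit-next s (later v) (isSuccessor (there y∈L) x<y closest) =
      later (visit-next (Linked.tail s) v (isSuccessor y∈L x<y (closest ∘ there)))

    -- The greatest point of a sorted list is its last entry, where the run ends.
    visit-last : ∀ {q s} → Linked _<_ L → Visit q L x s → IsGreatest L x → run step ρ q L ≡ s
    visit-last [-] (now _) _ = refl
    visit-last (z<w ∷ s) (now x≈z) (_ , x-max) =
      contradiction (<-respˡ-≈ (Eq.sym x≈z) z<w) (x-max (there (here Eq.refl)))
    visit-last s (later v) (_ , x-max) = visit-last (Linked.tail s) v (visit-∈ v , x-max ∘ there)

    certificate-complete : Cover ρ L → T (accepts A ρ L) →
      Certificate (0# ∷ L) (λ q → visits q start (0# ∷ L))
    certificate-complete {L = L} cov acc = record
      { 0∈U   = here Eq.refl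
      ; ρ⊆U   = λ j → cover-∈ {ρ = ρ} cov
      ; first = from (∈-visits start (0# ∷ L)) (now Eq.refl)
      ; next  = λ x∈Q _ x-next → from (∈-visits start (0# ∷ L))
          (visit-next (Cover.sorted cov) (to (∈-visits start (0# ∷ L)) x∈Q) x-next)
      ; last  = λ x∈Q x-max → subst (T ∘ final)
          (visit-last (Cover.sorted cov) (to (∈-visits start (0# ∷ L)) x∈Q) x-max) acc
      }

  -- Certificates and the description formula.

  module _ {k} (A : Automaton n)
    {u : Term k} {Aᵗ Cᵗ : Fin n → Term k} {Qᵗ : Fin (Automaton.states A) → Term k}
    {ρ : Vector FinSet n} {τ : Vector FinSet k} (Aᵗ≡ : ∀ j → ⟦ Aᵗ j ⟧ τ ≡ ρ j) where

    open Automaton A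
    open Description A u Aᵗ Cᵗ Qᵗ

    private
      U : FinSet
      U = ⟦ u ⟧ τ
      Q : Fin states → FinSet
      Q q = ⟦ Qᵗ q ⟧ τ

    Complements : Set (c ⊔ ℓ₁)
    Complements = ∀ j {x} → x ∈ U → x ∈ ⟦ Cᵗ j ⟧ τ ⇔ x ∉ ρ j

    -- The families of terms and the tuple are generalised because induction on the letter drops
    -- their first members.
    ∈-letterᵗ : ∀ {n} {Aᵗ Cᵗ : Fin n → Term k} {ρ : Vector FinSet n} a → x ∈ U →
      (∀ j → ⟦ Aᵗ j ⟧ τ ≡ ρ j) → (∀ j → x ∈ ⟦ Cᵗ j ⟧ τ ⇔ x ∉ ρ j) →
      x ∈ ⟦ letterᵗ a Aᵗ Cᵗ ⟧ τ ⇔ letter ρ x ≡ a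
    ∈-letterᵗ [] x∈U Aᵗ≡ Cᵗ⇔ = mk⇔ (λ _ → refl) (λ _ → x∈U)
    ∈-letterᵗ {x = x} {Aᵗ = Aᵗ} {Cᵗ} {ρ} (b ∷ a) x∈U Aᵗ≡ Cᵗ⇔ = mk⇔
      (λ x∈ → let x∈b , x∈a = ∈-∩⁻ x∈ in cong₂ _∷_ (to (head⇔ b) x∈b) (to tail⇔ x∈a))
      (λ ≡a → let ≡b , ≡a = ∷-injective ≡a in
        ∈-∩⁺ {B = ⟦ letterᵗ a (Aᵗ ∘ suc) (Cᵗ ∘ suc) ⟧ τ} (from (head⇔ b) ≡b) (from tail⇔ ≡a))
      where
      tail⇔ : x ∈ ⟦ letterᵗ a (Aᵗ ∘ suc) (Cᵗ ∘ suc) ⟧ τ ⇔ letter (ρ ∘ suc) x ≡ a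
      tail⇔ = ∈-letterᵗ a x∈U (Aᵗ≡ ∘ suc) (Cᵗ⇔ ∘ suc)
      head⇔ : ∀ b → x ∈ ⟦ (if b then Aᵗ zero else Cᵗ zero) ⟧ τ ⇔ does (x ∈? ρ zero) ≡ b
      head⇔ true rewrite Aᵗ≡ zero with x ∈? ρ zero
      ... | yes x∈ = mk⇔ (λ _ → refl) (λ _ → x∈)
      ... | no  x∉ = mk⇔ (λ x∈ → contradiction x∈ x∉) (λ ())
      head⇔ false with x ∈? ρ zero
      ... | yes x∈ = mk⇔ (λ x∈C → contradiction x∈ (to (Cᵗ⇔ zero) x∈C)) (λ ())
      ... | no  x∉ = mk⇔ (λ _ → refl) (λ _ → from (Cᵗ⇔ zero) x∉)

    description⇒certificate : τ ⊨ description → Certificate A ρ U Q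
    description⇒certificate (c₀⊑ , Aᵗ⊑ , ⊑Aᵗ∪Cᵗ , Aᵗ∩Cᵗ⊑ , first⊑ , next⊑ , last⊑) = record
      { 0∈U   = 0∈U
      ; ρ⊆U   = λ j x∈ → to (⊑ᵗ-⇔ (Aᵗ j) u) (to (⋀-⇔ ∈-allFin) Aᵗ⊑ j) (subst (_ ∈_) (≡-sym (Aᵗ≡ j)) x∈)
      ; first = to (⊑ᵗ-⇔ (c₀ᵗ ∩ᵗ letterᵗ (letter ρ 0#) Aᵗ Cᵗ) (Qᵗ _)) (to (⋀-⇔ ∈-letters) first⊑ (letter ρ 0#))
                  (∈-∩⁺ {B = ⟦ letterᵗ (letter ρ 0#) Aᵗ Cᵗ ⟧ τ} (here Eq.refl) (∈-own-letter 0∈U))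
      ; next  = next
      ; last  = last
      }
      where
      0∈U : 0# ∈ U
      0∈U = to (⊑ᵗ-⇔ c₀ᵗ u) c₀⊑ (here Eq.refl)

      complements : Complements
      complements j {x} x∈U = mk⇔
        (λ x∈C x∈ρ → contradiction
          (to (⊑ᵗ-⇔ (Aᵗ j ∩ᵗ Cᵗ j) ⊥ᵗ) (to (⋀-⇔ ∈-allFin) Aᵗ∩Cᵗ⊑ j)
            (∈-∩⁺ {B = ⟦ Cᵗ j ⟧ τ} (subst (_ ∈_) (≡-sym (Aᵗ≡ j)) x∈ρ) x∈C)) λ ())
        (λ x∉ρ → Sum.[ (λ x∈A → contradiction (subst (x ∈_) (Aᵗ≡ j) x∈A) x∉ρ) , id ]
          (Membershipₚ.∈-++⁻ Eq.setoid (⟦ Aᵗ j ⟧ τ)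
            (to (⊑ᵗ-⇔ u (Aᵗ j ∪ᵗ Cᵗ j)) (to (⋀-⇔ ∈-allFin) ⊑Aᵗ∪Cᵗ j) x∈U)))

      ∈-own-letter : ∀ {x} → x ∈ U → x ∈ ⟦ letterᵗ (letter ρ x) Aᵗ Cᵗ ⟧ τ
      ∈-own-letter x∈U = from (∈-letterᵗ _ x∈U Aᵗ≡ (λ j → complements j x∈U)) refl

      next : ∀ {q x y} → x ∈ Q q → x ∈ U → IsSuccessor U x y → y ∈ Q (step (letter ρ y) q)
      next {q} {x} {y} x∈Q x∈U x-next
        with to (∈-ips U (Q (step (letter ρ y) q)))
          (to (⊑ᵗ-⇔ (Qᵗ q ∩ᵗ ipsᵗ u (letterᵗ (letter ρ y) Aᵗ Cᵗ)) (ipsᵗ u (Qᵗ (step (letter ρ y) q))))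
            (to (⋀-⇔ ∈-letters) (to (⋀-⇔ ∈-allFin) next⊑ q) (letter ρ y))
            (∈-∩⁺ {B = ips U (⟦ letterᵗ (letter ρ y) Aᵗ Cᵗ ⟧ τ)} x∈Q
              (from (∈-ips U (⟦ letterᵗ (letter ρ y) Aᵗ Cᵗ ⟧ τ))
                (x∈U , y , x-next , ∈-own-letter (IsSuccessor.member x-next)))))
      -- The inclusion provides some successor of `x` in the required set; uniqueness of successors
      -- identifies it with `y`.
      ... | _ , y′ , x-next′ , y′∈Q = ∈-resp-≈ (Q (step (letter ρ y) q)) (isSuccessor-unique x-next′ x-next) y′∈Q

      last : ∀ {q x} → x ∈ Q q → IsGreatest U x → T (final q)
      last {q} x∈Q x-max with final q | to (⋀-⇔ ∈-allFin) last⊑ q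
      ... | true  | _ = _
      ... | false | last⊑q = contradiction
        (to (⊑ᵗ-⇔ (maxᵗ u ∩ᵗ Qᵗ q) ⊥ᵗ) last⊑q (∈-∩⁺ {B = Q q} (from (∈-max U) x-max) x∈Q)) λ ()

    certificate⇒description : Complements → Certificate A ρ U Q → τ ⊨ description
    certificate⇒description complements certificate =
        from (⊑ᵗ-⇔ c₀ᵗ u) (λ x∈ → ∈-resp-≈ U (Eq.sym (∈-[]⁻ x∈)) 0∈U)
      , from (⋀-⇔ ∈-allFin) (λ j → from (⊑ᵗ-⇔ (Aᵗ j) u) (λ x∈ → ρ⊆U j (subst (_ ∈_) (Aᵗ≡ j) x∈)))
      , from (⋀-⇔ ∈-allFin) (λ j → from (⊑ᵗ-⇔ u (Aᵗ j ∪ᵗ Cᵗ j)) (∈-A∪C j))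
      , from (⋀-⇔ ∈-allFin) (λ j → from (⊑ᵗ-⇔ (Aᵗ j ∩ᵗ Cᵗ j) ⊥ᵗ) (∉-A∩C j))
      , from (⋀-⇔ ∈-letters) (λ a → from (⊑ᵗ-⇔ (c₀ᵗ ∩ᵗ letterᵗ a Aᵗ Cᵗ) (Qᵗ (step a start))) (∈-first a))
      , from (⋀-⇔ ∈-allFin) (λ q → from (⋀-⇔ ∈-letters) λ a →
          from (⊑ᵗ-⇔ (Qᵗ q ∩ᵗ ipsᵗ u (letterᵗ a Aᵗ Cᵗ)) (ipsᵗ u (Qᵗ (step a q)))) (∈-next q a))
      , from (⋀-⇔ ∈-allFin) (λ q → from (⊑ᵗ-⇔ (maxᵗ u ∩ᵗ Qᵗ q) (if final q then u else ⊥ᵗ)) (∈-last q))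
      where
      open Certificate certificate

      letter-of : ∀ a {x} → x ∈ U → x ∈ ⟦ letterᵗ a Aᵗ Cᵗ ⟧ τ → letter ρ x ≡ a
      letter-of a x∈U = to (∈-letterᵗ a x∈U Aᵗ≡ (λ j → complements j x∈U))

      ∈-A∪C : ∀ j {x} → x ∈ U → x ∈ ⟦ Aᵗ j ∪ᵗ Cᵗ j ⟧ τ
      ∈-A∪C j {x} x∈U with x ∈? ρ j
      ... | yes x∈ρ = Membershipₚ.∈-++⁺ˡ Eq.setoid (subst (x ∈_) (≡-sym (Aᵗ≡ j)) x∈ρ)
      ... | no  x∉ρ = Membershipₚ.∈-++⁺ʳ Eq.setoid (⟦ Aᵗ j ⟧ τ) (from (complements j x∈U) x∉ρ)

      ∉-A∩C : ∀ j {x} → x ∈ ⟦ Aᵗ j ∩ᵗ Cᵗ j ⟧ τ → x ∈ []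
      ∉-A∩C j x∈ with ∈-∩⁻ {B = ⟦ Cᵗ j ⟧ τ} x∈
      ... | x∈A , x∈C = contradiction (subst (_ ∈_) (Aᵗ≡ j) x∈A)
                          (to (complements j (ρ⊆U j (subst (_ ∈_) (Aᵗ≡ j) x∈A))) x∈C)

      ∈-first : ∀ a {x} → x ∈ ⟦ c₀ᵗ ∩ᵗ letterᵗ a Aᵗ Cᵗ ⟧ τ → x ∈ Q (step a start)
      ∈-first a x∈ with ∈-∩⁻ {B = ⟦ letterᵗ a Aᵗ Cᵗ ⟧ τ} x∈
      ... | here x≈0 , x∈a with letter-of a 0∈U (∈-resp-≈ (⟦ letterᵗ a Aᵗ Cᵗ ⟧ τ) x≈0 x∈a)
      ...   | refl = ∈-resp-≈ (Q (step a start)) (Eq.sym x≈0) first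

      ∈-next : ∀ q a {x} → x ∈ ⟦ Qᵗ q ∩ᵗ ipsᵗ u (letterᵗ a Aᵗ Cᵗ) ⟧ τ → x ∈ ips U (Q (step a q))
      ∈-next q a x∈ with ∈-∩⁻ {B = ips U (⟦ letterᵗ a Aᵗ Cᵗ ⟧ τ)} x∈
      ... | x∈Q , x∈ips with to (∈-ips U (⟦ letterᵗ a Aᵗ Cᵗ ⟧ τ)) x∈ips
      ...   | x∈U , y , x-next , y∈a with letter-of a (IsSuccessor.member x-next) y∈a
      ...     | refl = from (∈-ips U (Q (step a q))) (x∈U , y , x-next , next x∈Q x∈U x-next)

      ∈-last : ∀ q {x} → x ∈ ⟦ maxᵗ u ∩ᵗ Qᵗ q ⟧ τ → x ∈ ⟦ (if final q then u else ⊥ᵗ) ⟧ τ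
      ∈-last q x∈ with ∈-∩⁻ {B = Q q} x∈
      ... | x∈max , x∈Q with final q | last x∈Q (to (∈-max U) x∈max)
      -- A rejecting `q` is ruled out by `last`, so the right-hand side is `u`.
      ...   | true | _ = proj₁ (to (∈-max U) x∈max)

  -- Recognisable relations are positive existential.

  definable⇒positive : {P : Vector FinSet n → Set p} → Definable P →
    Σ[ ψ ∈ Formula n ] PositiveExistential ψ × (∀ ρ → P ρ ⇔ (ρ ⊨ ψ))
  definable⇒positive {n} {P = P} (A , A-rec) =
    (∃ᶠ ∃ⁿ n (∃ⁿ states description))
    , (∃ᵖ ∃ⁿ-positive n (∃ⁿ-positive states description-positive))
    , λ ρ → mk⇔ (complete ρ) (sound ρ)
    where
    open Automaton A

    -- In order of index, the variables are the state sets, the complements, U, and finally the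
    -- given tuple.
    u : Term (states + (n + suc n))
    u = var (states ↑ʳ (n ↑ʳ zero))

    Aᵗ Cᵗ : Fin n → Term (states + (n + suc n))
    Aᵗ j = var (states ↑ʳ (n ↑ʳ suc j))
    Cᵗ j = var (states ↑ʳ (j ↑ˡ suc n))

    Qᵗ : Fin states → Term (states + (n + suc n))
    Qᵗ q = var (q ↑ˡ (n + suc n))

    open Description A u Aᵗ Cᵗ Qᵗ

    module _ (Qs : Vec FinSet states) (Cs : Vec FinSet n) (U : FinSet) (ρ : Vector FinSet n) where

      environment : Vector FinSet (states + (n + suc n))
      environment = extend Qs (extend Cs (U Vector.∷ ρ))

      ⟦u⟧ : ⟦ u ⟧ environment ≡ U
      ⟦u⟧ = ≡-trans (extend-↑ʳ Qs _ (n ↑ʳ zero)) (extend-↑ʳ Cs (U Vector.∷ ρ) zero)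

      ⟦Aᵗ⟧ : ∀ j → ⟦ Aᵗ j ⟧ environment ≡ ρ j
      ⟦Aᵗ⟧ j = ≡-trans (extend-↑ʳ Qs _ (n ↑ʳ suc j)) (extend-↑ʳ Cs (U Vector.∷ ρ) (suc j))

      ⟦Cᵗ⟧ : ∀ j → ⟦ Cᵗ j ⟧ environment ≡ Vec.lookup Cs j
      ⟦Cᵗ⟧ j = ≡-trans (extend-↑ʳ Qs _ (j ↑ˡ suc n)) (extend-↑ˡ Cs (U Vector.∷ ρ) j)

      ⟦Qᵗ⟧ : ∀ q → ⟦ Qᵗ q ⟧ environment ≡ Vec.lookup Qs q
      ⟦Qᵗ⟧ q = extend-↑ˡ Qs (extend Cs (U Vector.∷ ρ)) q

    sound : ∀ ρ → ρ ⊨ ∃ᶠ ∃ⁿ n (∃ⁿ states description) → P ρ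
    sound ρ (U , ⊨∃) with to (∃ⁿ-⇔ n) ⊨∃
    ... | Cs , ⊨∃′ with to (∃ⁿ-⇔ states) ⊨∃′
    ...   | Qs , ⊨description
      -- The cover extracted from `U` is not chosen in advance; recognition on all covers makes its
      -- verdict valid.
      with certificate-sound A ρ (description⇒certificate A {ρ = ρ} (⟦Aᵗ⟧ Qs Cs U ρ) ⊨description)
    ...     | L , cov , acc = reflects⇒ (A-rec cov) acc

    complete : ∀ ρ → P ρ → ρ ⊨ ∃ᶠ ∃ⁿ n (∃ⁿ states description)
    complete ρ Pρ with cover-exists ρ
    ... | L , cov = U , from (∃ⁿ-⇔ n) (Cs , from (∃ⁿ-⇔ states) (Qs ,
            certificate⇒description A {ρ = ρ} (⟦Aᵗ⟧ Qs Cs U ρ) complements certificate))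
      where
      U : FinSet
      U = 0# ∷ L
      C : Fin n → FinSet
      C j = filter (λ x → ¬? (x ∈? ρ j)) U
      Q : Fin states → FinSet
      Q q = visits A ρ q start U
      Cs = Vec.tabulate C
      Qs = Vec.tabulate Q
      τ  = environment Qs Cs U ρ

      ∉-resp-≈ : ∀ {j x y} → x ≈ y → x ∉ ρ j → y ∉ ρ j
      ∉-resp-≈ {j} x≈y x∉ y∈ = x∉ (∈-resp-≈ (ρ j) (Eq.sym x≈y) y∈)

      complements : ∀ j {x} → x ∈ ⟦ u ⟧ τ → x ∈ ⟦ Cᵗ j ⟧ τ ⇔ x ∉ ρ j
      complements j {x} x∈U rewrite ⟦u⟧ Qs Cs U ρ | ⟦Cᵗ⟧ Qs Cs U ρ j | lookup∘tabulate C j = mk⇔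
        (λ x∈C → proj₂ (Membershipₚ.∈-filter⁻ Eq.setoid (λ x → ¬? (x ∈? ρ j)) ∉-resp-≈ x∈C))
        (λ x∉ρ → Membershipₚ.∈-filter⁺ Eq.setoid (λ x → ¬? (x ∈? ρ j)) ∉-resp-≈ x∈U x∉ρ)

      certificate : Certificate A ρ (⟦ u ⟧ τ) (λ q → ⟦ Qᵗ q ⟧ τ)
      certificate = certificate-cong A ρ (≡-sym (⟦u⟧ Qs Cs U ρ))
        (λ q → ≡-sym (≡-trans (⟦Qᵗ⟧ Qs Cs U ρ q) (lookup∘tabulate Q q)))
        (certificate-complete A ρ cov (reflects⇐ (A-rec cov) Pρ))

theorem3p6 : ∀ {c ℓ₁ ℓ₂} (I : DenseLinearOrder c ℓ₁ ℓ₂) → let open DenseLinearOrder I in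
    (0# : Carrier) →
    (∀ x → ¬ (x < 0#)) →
    (∀ x → ∃[ y ] x < y) →
    PositiveModelComplete (𝒲 I 0#)
theorem3p6 I 0# 0-least unbounded φ = definable⇒positive (definable-⊨ φ)
  where open Definability I 0# 0-least unbounded
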